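{- Let $A\in\mathcal{V}$ and $\theta\in Con(A)$. The following are equivalent: (1) $\theta$ has $CBLP$; (2) for all congruences $\phi,\psi$ of $A$ with $\phi\vee\psi=\nabla_A$ and $[\phi,\psi]\subseteq\theta$, there exists $\alpha\in B(Con(A))$ with $\alpha\subseteq\theta\vee\phi$ and $\neg\alpha\subseteq\theta\vee\psi$; (3) for all congruences $\phi,\psi$ of $A$ with $\phi\vee\psi=\nabla_A$ and $[\phi,\psi]=\theta$, there exists $\alpha\in B(Con(A))$ with $\alpha\subseteq\theta\vee\phi$ and $\neg\alpha\subseteq\theta\vee\psi$; (4) for every maximal congruence $\phi$ of $A$, $|B(Con(A/(\theta\vee\phi^{\diamond})))|\leq 2$.
   Context: $\mathcal{V}$ is a congruence modular, semidegenerate variety (no nontrivial algebra has a one-element subalgebra) of finite signature. For $B\in\mathcal{V}$: $Con(B)$ is its congruence lattice with bounds $\Delta_B,\nabla_B$, $[\cdot,\cdot]$ the Freese–McKenzie commutator, $K(B)$ the compact congruences. A congruence $\phi\neq\nabla_B$ is prime if $[\alpha,\beta]\subseteq\phi$ implies $\alpha\subseteq\phi$ or $\beta\subseteq\phi$; $\rho(\theta)$ is the intersection of primes containing $\theta$. $B(Con(B))$ is the Boolean algebra of complemented elements of $Con(B)$, with complement $\neg\alpha$. When $K(B)$ is closed under the commutator, the reticulation $L(B)=K(B)/{\equiv}$ ($\alpha\equiv\beta$ iff $\rho(\alpha)=\rho(\beta)$) is a bounded distributive lattice with canonical map $\lambda_B$, mapping $B(Con(B))$ injectively into $B(L(B))$;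 the reticulation preserves the Boolean center if this map is onto $B(L(B))$. Standing assumption: for every $B\in\mathcal{V}$, $K(B)$ is closed under the commutator and the reticulation of $B$ preserves the Boolean center. For $\phi\in Con(A)$, $\phi^{\diamond}=\bigvee\{\alpha\in B(Con(A)):\alpha\subseteq\phi\}$. A congruence $\theta$ of $A$ has $CBLP$ if for every $\beta\in B(Con(A/\theta))$ there is $\alpha\in B(Con(A))$ with $(\alpha\vee\theta)/\theta=\beta$. -}

module Defs where

open import Level using (Level; _⊔_; suc; Lift; lift; lower)
open import Axiom.ExcludedMiddle using (ExcludedMiddle)
open import Algebra.Lattice.Bundles.Raw using (RawLattice)
open import Data.Fin.Base using (Fin)
open import Data.List.Base using (List; []; _∷_; _++_; foldr)
open import Data.List.Relation.Unary.All using (All)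
open import Data.List.Relation.Unary.All.Properties using (++⁺)
open import Data.Nat.Base using (ℕ)
open import Data.Product.Base using (Σ; ∃; _×_; _,_; proj₁; proj₂; swap)
open import Data.Sum.Base using (_⊎_; inj₁; inj₂; [_,_]′)
open import Data.Unit.Polymorphic.Base using (⊤; tt)
open import Function.Bundles using (Injection)
open import Relation.Binary.Bundles using (Setoid; Poset)
open import Relation.Binary.Core using (Rel)
open import Relation.Binary.PropositionalEquality.Properties using (setoid)
open import Relation.Binary.Structures using (IsEquivalence)
open import Relation.Nullary.Decidable.Core using (True; toWitness; fromWitness)
open import Relation.Nullary.Negation.Core using (¬_)
open import Relation.Unary using (Pred)

-- The empty predicate is a chain, so the premise already
-- makes the poset inhabited.
ZornsLemma : ∀ a ℓ₁ ℓ₂ c → Set (suc (a ⊔ ℓ₁ ⊔ ℓ₂ ⊔ c))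
ZornsLemma a ℓ₁ ℓ₂ c =
  (P : Poset a ℓ₁ ℓ₂) → let open Poset P in
  ((C : Pred Carrier c) → (∀ x y → C x → C y → x ≤ y ⊎ y ≤ x) →
    ∃ λ b → ∀ x → C x → x ≤ b) →
  ∃ λ m → ∀ x → m ≤ x → x ≈ m

-- Bounds are expressed through the operations, so that the top of the
-- reticulation can be used without first proving ∇ compact.
module _ {c ℓ} (L : RawLattice c ℓ) where
  open RawLattice L

  IsTop IsBottom : Pred Carrier (c ⊔ ℓ)
  IsTop    t = ∀ x → t ∨ x ≈ t
  IsBottom b = ∀ x → b ∧ x ≈ b

  ComplementedIn : Pred Carrier (c ⊔ ℓ)
  ComplementedIn x = ∃ λ y → IsTop (x ∨ y) × IsBottom (x ∧ y)

record Signature : Set where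
  field
    #ops  : ℕ
    arity : Fin #ops → ℕ

open Signature public

data Term (S : Signature) (X : Set) : Set where
  var : X → Term S X
  app : (f : Fin (#ops S)) → (Fin (arity S f) → Term S X) → Term S X

record Algebra (S : Signature) (u : Level) : Set (suc u) where
  field
    Carrier       : Set u
    _≈_           : Rel Carrier u
    isEquivalence : IsEquivalence _≈_
    op            : (f : Fin (#ops S)) → (Fin (arity S f) → Carrier) → Carrier
    op-cong       : ∀ f {xs ys} → (∀ i → xs i ≈ ys i) → op f xs ≈ op f ys

  ⟦_⟧ : ∀ {X : Set} → Term S X → (X → Carrier) → Carrier
  ⟦ var x ⟧    η = η x
  ⟦ app f ts ⟧ η = op f (λ i → ⟦ ts i ⟧ η)

-- A variety is the class of models of a set of identities.
record Variety (u : Level) : Set (suc u) where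
  field
    signature : Signature
    Identity  : Rel (Term signature ℕ) u

  Alg : Set (suc u)
  Alg = Algebra signature u

open Variety public using (signature; Identity; Alg)

infix 4 _∋_

_∋_ : ∀ {u} (V : Variety u) → Alg V → Set u
V ∋ B = ∀ s t → Identity V s t → ∀ η → ⟦ s ⟧ η ≈ ⟦ t ⟧ η
  where open Algebra B

module _ {S : Signature} {u : Level} where

  record Con (A : Algebra S u) : Set (suc u) where
    open Algebra A using (Carrier; _≈_; op)
    field
      rel           : Rel Carrier u
      isEquivalence : IsEquivalence rel
      reflexive     : ∀ {a b} → a ≈ b → rel a b
      compatible    : ∀ f {xs ys} → (∀ i → rel (xs i) (ys i)) →
                      rel (op f xs) (op f ys)

  open Con public using (rel)

  -- The quotient keeps the carrier and takes the congruence as equality.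
  infixl 8 _/_
  _/_ : (A : Algebra S u) → Con A → Algebra S u
  A / θ = record
    { Carrier       = Carrier
    ; _≈_           = rel θ
    ; isEquivalence = Con.isEquivalence θ
    ; op            = op
    ; op-cong       = Con.compatible θ
    } where open Algebra A

  module _ {A : Algebra S u} where
    open Algebra A using (Carrier; _≈_; op; ⟦_⟧)
    private module A = Algebra A

    infix 4 _⊆_ _≐_

    _⊆_ _≐_ : Rel (Con A) u
    α ⊆ β = ∀ {a b} → rel α a b → rel β a b
    α ≐ β = (α ⊆ β) × (β ⊆ α)

    Δ ∇ : Con A
    Δ = record
      { rel           = _≈_
      ; isEquivalence = A.isEquivalence
      ; reflexive     = λ p → p
      ; compatible    = A.op-cong
      }
    ∇ = record
      { rel           = λ _ _ → ⊤
      ; isEquivalence = record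
        { refl = tt ; sym = λ _ → tt ; trans = λ _ _ → tt }
      ; reflexive     = λ _ → tt
      ; compatible    = λ _ _ → tt
      }

    data Generated (R : Rel Carrier u) : Rel Carrier u where
      base  : ∀ {a b} → R a b → Generated R a b
      equal : ∀ {a b} → a ≈ b → Generated R a b
      sym   : ∀ {a b} → Generated R a b → Generated R b a
      trans : ∀ {a b c} → Generated R a b → Generated R b c → Generated R a c
      comp  : ∀ f {xs ys} → (∀ i → Generated R (xs i) (ys i)) →
              Generated R (op f xs) (op f ys)

    Cg : Rel Carrier u → Con A
    Cg R = record
      { rel           = Generated R
      ; isEquivalence = record
        { refl  = equal (IsEquivalence.refl A.isEquivalence)
        ; sym   = sym
        ; trans = trans
        }
      ; reflexive     = equal
      ; compatible    = comp
      }

    Cg-least : ∀ {R} (γ : Con A) → (∀ {a b} → R a b → rel γ a b) → Cg R ⊆ γ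
    Cg-least γ R⊆γ (base p)    = R⊆γ p
    Cg-least γ R⊆γ (equal p)   = Con.reflexive γ p
    Cg-least γ R⊆γ (sym p)     =
      IsEquivalence.sym (Con.isEquivalence γ) (Cg-least γ R⊆γ p)
    Cg-least γ R⊆γ (trans p q) =
      IsEquivalence.trans (Con.isEquivalence γ)
        (Cg-least γ R⊆γ p) (Cg-least γ R⊆γ q)
    Cg-least γ R⊆γ (comp f ps) =
      Con.compatible γ f (λ i → Cg-least γ R⊆γ (ps i))

    infixr 6 _∨_
    infixr 7 _∩_

    _∨_ _∩_ : Con A → Con A → Con A
    α ∨ β = Cg (λ a b → rel α a b ⊎ rel β a b)
    α ∩ β = record
      { rel           = λ a b → rel α a b × rel β a b
      ; isEquivalence = record
        { refl  = E.refl α , E.refl β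
        ; sym   = λ (p , q) → E.sym α p , E.sym β q
        ; trans = λ (p , q) (p′ , q′) → E.trans α p p′ , E.trans β q q′
        }
      ; reflexive     = λ p → Con.reflexive α p , Con.reflexive β p
      ; compatible    = λ f ps → Con.compatible α f (λ i → proj₁ (ps i))
                               , Con.compatible β f (λ i → proj₂ (ps i))
      } where module E γ = IsEquivalence (Con.isEquivalence γ)

    Maximal : Con A → Set (suc u)
    Maximal φ = ¬ (φ ≐ ∇) × (∀ ψ → φ ⊆ ψ → ¬ (ψ ≐ ∇) → ψ ≐ φ)

    IsComplement : Con A → Con A → Set u
    IsComplement α β = (α ∨ β ≐ ∇) × (α ∩ β ≐ Δ)

    Complemented : Con A → Set (suc u)
    Complemented α = ∃ λ β → IsComplement α β

    -- The term condition C(α,β;δ).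
    Centralizes : Con A → Con A → Con A → Set u
    Centralizes α β δ =
      ∀ {m n} (t : Term S (Fin m ⊎ Fin n))
      {a b : Fin m → Carrier} {c d : Fin n → Carrier} →
      (∀ i → rel α (a i) (b i)) → (∀ j → rel β (c j) (d j)) →
      rel δ (⟦ t ⟧ [ a , c ]′) (⟦ t ⟧ [ a , d ]′) →
      rel δ (⟦ t ⟧ [ b , c ]′) (⟦ t ⟧ [ b , d ]′)

    -- χ/θ, for θ ⊆ χ.
    quotient : ∀ {θ} (χ : Con A) → θ ⊆ χ → Con (A / θ)
    quotient χ θ⊆χ = record
      { rel           = rel χ
      ; isEquivalence = Con.isEquivalence χ
      ; reflexive     = θ⊆χ
      ; compatible    = Con.compatible χ
      }

    ∨-upperʳ : ∀ (α θ : Con A) → θ ⊆ α ∨ θ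
    ∨-upperʳ α θ p = base (inj₂ p)

  -- Elements of B(Con(A)).  In a semidegenerate congruence modular variety
  -- complements are unique up to ≐, so ¬α may be carried as a field.
  record BCon (A : Algebra S u) : Set (suc u) where
    field
      con          : Con A
      neg          : Con A
      isComplement : IsComplement con neg

  open BCon public using (con; neg)

  BConSetoid : Algebra S u → Setoid (suc u) u
  BConSetoid A = record
    { Carrier       = BCon A
    ; _≈_           = λ α β → con α ≐ con β
    ; isEquivalence = record
      { refl  = (λ p → p) , (λ p → p)
      ; sym   = swap
      ; trans = λ (p , p′) (q , q′) → (λ x → q (p x)) , (λ x → p′ (q′ x))
      }
    }

  CBLP : {A : Algebra S u} → Con A → Set (suc u)
  CBLP {A} θ = (β : BCon (A / θ)) →
    ∃ λ (α : BCon A) → quotient {θ = θ} (con α ∨ θ) (∨-upperʳ (con α) θ) ≐ con β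

  Trivial : Algebra S u → Set u
  Trivial A = ∀ x y → x ≈ y
    where open Algebra A

  IsSubuniverse : (A : Algebra S u) → Pred (Algebra.Carrier A) u → Set u
  IsSubuniverse A P = ∀ f {xs} → (∀ i → P (xs i)) → P (op f xs)
    where open Algebra A

  HasOneElementSubalgebra : Algebra S u → Set u
  HasOneElementSubalgebra A = ∃ λ a → IsSubuniverse A (λ x → x ≈ a)
    where open Algebra A

-- |X| ≤ n
AtMost : ∀ {c ℓ} → ℕ → Setoid c ℓ → Set (c ⊔ ℓ)
AtMost n X = Injection X (setoid (Fin n))

CongruenceModular : ∀ {u} → Variety u → Set (suc u)
CongruenceModular V = ∀ B → V ∋ B → ∀ (α β γ : Con B) →
  α ⊆ γ → α ∨ (β ∩ γ) ≐ (α ∨ β) ∩ γ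

Semidegenerate : ∀ {u} → Variety u → Set (suc u)
Semidegenerate V = ∀ B → V ∋ B → ¬ Trivial B → ¬ HasOneElementSubalgebra B

-- Notions that use arbitrary meets and joins in Con(A).  Quantifying over
-- Con(A) raises the universe level; excluded middle brings propositions
-- back down.  In particular every subset of Con(A) is extensionally equal
-- to one given by a predicate valued in Set u.
module Classical {u : Level} (em : ExcludedMiddle (suc u)) where

  ⌊_⌋ : Set (suc u) → Set u
  ⌊ P ⌋ = Lift u (True (em {P = P}))

  ⌊⌋-intro : ∀ {P} → P → ⌊ P ⌋
  ⌊⌋-intro p = lift (fromWitness p)

  ⌊⌋-elim : ∀ {P} → ⌊ P ⌋ → P
  ⌊⌋-elim (lift p) = toWitness p

  module _ {S : Signature} {A : Algebra S u} where

    infixr 6 ⋁_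
    infixr 7 ⋀_

    ⋁_ ⋀_ : Pred (Con A) u → Con A
    ⋁ P = Cg (λ a b → ⌊ (∃ λ α → P α × rel α a b) ⌋)
    ⋀ P = record
      { rel           = λ a b → ⌊ (∀ α → P α → rel α a b) ⌋
      ; isEquivalence = record
        { refl  = ⌊⌋-intro (λ α _ → E.refl α)
        ; sym   = λ p → ⌊⌋-intro (λ α Pα → E.sym α (⌊⌋-elim p α Pα))
        ; trans = λ p q → ⌊⌋-intro (λ α Pα →
                    E.trans α (⌊⌋-elim p α Pα) (⌊⌋-elim q α Pα))
        }
      ; reflexive     = λ p → ⌊⌋-intro (λ α _ → Con.reflexive α p)
      ; compatible    = λ f ps → ⌊⌋-intro (λ α Pα →
                          Con.compatible α f (λ i → ⌊⌋-elim (ps i) α Pα))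
      } where module E γ = IsEquivalence (Con.isEquivalence γ)

    -- The commutator: the least δ with C(α,β;δ).
    [_,_] : Con A → Con A → Con A
    [ α , β ] = ⋀ Centralizes α β

    Compact : Con A → Set (suc u)
    Compact α = (P : Pred (Con A) u) → α ⊆ ⋁ P →
      ∃ λ (αs : List (Con A)) → All P αs × (α ⊆ foldr _∨_ Δ αs)

    Prime : Con A → Set (suc u)
    Prime φ = ¬ (φ ≐ ∇) × (∀ α β → [ α , β ] ⊆ φ → α ⊆ φ ⊎ β ⊆ φ)

    ρ : Con A → Con A
    ρ θ = ⋀ (λ φ → ⌊ Prime φ ⌋ × (θ ⊆ φ))

    infix 9 _◇
    _◇ : Con A → Con A
    φ ◇ = ⋁ (λ α → ⌊ Complemented α ⌋ × (α ⊆ φ))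

    private
      weakenˡ : ∀ (αs βs : List (Con A)) →
                foldr _∨_ Δ αs ⊆ foldr _∨_ Δ (αs ++ βs)
      weakenˡ []       βs p = Con.reflexive (foldr _∨_ Δ βs) p
      weakenˡ (α ∷ αs) βs   = Cg-least (α ∨ foldr _∨_ Δ (αs ++ βs))
        λ { (inj₁ p) → base (inj₁ p) ; (inj₂ p) → base (inj₂ (weakenˡ αs βs p)) }

      weakenʳ : ∀ (αs βs : List (Con A)) →
                foldr _∨_ Δ βs ⊆ foldr _∨_ Δ (αs ++ βs)
      weakenʳ []       βs p = p
      weakenʳ (α ∷ αs) βs p = base (inj₂ (weakenʳ αs βs p))

    ∨-compact : ∀ α β → Compact α → Compact β → Compact (α ∨ β)
    ∨-compact α β cα cβ P α∨β⊆⋁P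
      with cα P (λ p → α∨β⊆⋁P (base (inj₁ p)))
         | cβ P (λ p → α∨β⊆⋁P (base (inj₂ p)))
    ... | αs , Pαs , α⊆ | βs , Pβs , β⊆ =
      αs ++ βs , ++⁺ Pαs Pβs ,
      Cg-least (foldr _∨_ Δ (αs ++ βs))
        λ { (inj₁ p) → weakenˡ αs βs (α⊆ p) ; (inj₂ p) → weakenʳ αs βs (β⊆ p) }

  module _ {S : Signature} (B : Algebra S u) where

    K : Set (suc u)
    K = Σ (Con B) Compact

    CompactClosed : Set (suc u)
    CompactClosed = ∀ (α β : Con B) → Compact α → Compact β → Compact [ α , β ]

    -- L(B).  Elements are represented by compact congruences, and the
    -- canonical map λ_B is the identity on representatives.
    Reticulation : CompactClosed → RawLattice (suc u) u
    Reticulation closed = record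
      { Carrier = K
      ; _≈_     = λ α β → ρ (proj₁ α) ≐ ρ (proj₁ β)
      ; _∧_     = λ (α , cα) (β , cβ) → [ α , β ] , closed α β cα cβ
      ; _∨_     = λ (α , cα) (β , cβ) → α ∨ β , ∨-compact α β cα cβ
      }

    PreservesBooleanCenter : CompactClosed → Set (suc u)
    PreservesBooleanCenter closed =
      ∀ x → ComplementedIn (Reticulation closed) x →
      ∃ λ (γ : K) → Complemented (proj₁ γ) × γ ≈ x
      where open RawLattice (Reticulation closed) using (_≈_)

{-# OPTIONS --safe #-}
module Submission where

-- Everything rests on the term condition C(α,β;δ).  On β, viewed as a
-- subalgebra of A², let Γ be the largest congruence for which {(x,y) : x δ y}
-- is a union of classes; then C(α,β;δ) says that (x,x) Γ (y,y) whenever x α y.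
-- So C(-,β;δ) passes to joins, modularity of Con(β) (the shifting lemma) makes
-- C symmetric in α, β and upward closed in δ, and semidegeneracy applied to
-- β/Γ shows that C(∇,β;δ) forces β ⊆ δ.  Hence if φ ∨ ψ = ∇, then C(φ,σ;δ) and
-- C(ψ,σ;δ) imply σ ⊆ δ, which yields (1) ⇒ (2) ⇒ (3) ⇒ (1).
--
-- (2) ⇒ (4): ∇ is compact, so a complemented pair modulo θ ∨ μ◇ contains compact
-- β, γ with β ∨ γ = ∇ and [β,γ] ⊆ θ ∨ α for a single α ∈ B(Con(A)) below μ.
-- By (2) the pair is separated by some ε ∈ B(Con(A)), and ε ⊆ μ or ¬ε ⊆ μ.
--
-- (4) ⇒ (3): let σ be the join of the complemented congruences below φ or below ψ.
-- If σ ≠ ∇, it lies in a maximal μ; by (4) φ or ψ is contained in θ ∨ μ◇, which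
-- produces a complemented congruence below ψ or φ that is not below μ.  So
-- σ = ∇, and compactness of ∇ gives the separating element.

open import Defs
open import Level using (Level; suc; Lift; lift; lower)
open import Axiom.ExcludedMiddle using (ExcludedMiddle)
open import Data.Product using (∃; _×_; _,_; proj₁; proj₂)
open import Function.Bundles using (_⇔_; mk⇔; Injection)
open import Data.Empty using (⊥-elim)
open import Data.Fin.Base using (Fin; splitAt; _↑ˡ_; _↑ʳ_)
open import Data.Fin.Properties using (splitAt-↑ˡ; splitAt-↑ʳ)
open import Data.List.Base using (List; []; _∷_; _++_; foldr)
open import Data.List.Relation.Unary.All using (All; []; _∷_)
open import Data.List.Relation.Unary.All.Properties using (++⁺)
open import Data.Nat.Base using (ℕ; _+_)
open import Data.Sum.Base using (_⊎_; inj₁; inj₂; [_,_]′)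
open import Data.Unit.Polymorphic.Base using (tt)
open import Function.Base using (_∘_; id)
open import Relation.Binary.Bundles using (Poset)
open import Relation.Binary.Core using (Rel)
open import Relation.Binary.PropositionalEquality.Core using (_≡_; refl; cong)
open import Relation.Binary.Structures using (IsEquivalence)
open import Relation.Nullary.Decidable.Core using (Dec; yes; no; map′; decidable-stable)
open import Relation.Nullary.Negation.Core using (¬_; contradiction)
open import Relation.Unary using (Pred)

private
  variable
    S : Signature
    u : Level
    X Y : Set

module Eq {S : Signature} {u : Level} {A : Algebra S u} (γ : Con A) =
  IsEquivalence (Con.isEquivalence γ)

-- Terms

substitute : (X → Term S Y) → Term S X → Term S Y
substitute σ (var x)    = σ x
substitute σ (app f ts) = app f (λ i → substitute σ (ts i))

module _ {S : Signature} {u : Level} {A : Algebra S u} where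
  open Algebra A

  ⟦⟧-compatible : (γ : Con A) (t : Term S X) {η η′ : X → Carrier} →
    (∀ x → rel γ (η x) (η′ x)) → rel γ (⟦ t ⟧ η) (⟦ t ⟧ η′)
  ⟦⟧-compatible γ (var x)    r = r x
  ⟦⟧-compatible γ (app f ts) r =
    Con.compatible γ f (λ i → ⟦⟧-compatible γ (ts i) r)

  ⟦⟧-substitute : (σ : X → Term S Y) (t : Term S X)
    {η : X → Carrier} {η′ : Y → Carrier} →
    (∀ x → ⟦ σ x ⟧ η′ ≈ η x) → ⟦ substitute σ t ⟧ η′ ≈ ⟦ t ⟧ η
  ⟦⟧-substitute σ (var x)    r = r x
  ⟦⟧-substitute σ (app f ts) r = op-cong f (λ i → ⟦⟧-substitute σ (ts i) r)

module _ {S : Signature} {u : Level} {A B : Algebra S u} where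
  private
    module A = Algebra A
    module B = Algebra B

  ⟦⟧-homomorphic : (h : A.Carrier → B.Carrier) →
    (∀ f xs → h (A.op f xs) B.≈ B.op f (h ∘ xs)) →
    (t : Term S X) (η : X → A.Carrier) → h (A.⟦ t ⟧ η) B.≈ B.⟦ t ⟧ (h ∘ η)
  ⟦⟧-homomorphic h h-op (var x)    η = Eq.refl {A = B} Δ
  ⟦⟧-homomorphic h h-op (app f ts) η = Eq.trans {A = B} Δ (h-op f _)
    (B.op-cong f (λ i → ⟦⟧-homomorphic h h-op (ts i) η))

quotient∈ : (V : Variety u) {A : Alg V} → V ∋ A → (θ : Con A) → V ∋ A / θ
quotient∈ V {A} A∈V θ s t s≈t η = Eq.trans θ (Eq.sym θ (same s))
  (Eq.trans θ (Con.reflexive θ (A∈V s t s≈t η)) (same t))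
  where
  same : ∀ r → rel θ (Algebra.⟦_⟧ A r η) (Algebra.⟦_⟧ (A / θ) r η)
  same r = ⟦⟧-homomorphic {A = A} {B = A / θ} id (λ f xs → Eq.refl θ) r η

-- The syntactic congruence of a predicate

module Syntactic {S : Signature} {u : Level} {A : Algebra S u}
  (D : Pred (Algebra.Carrier A) u) (resp : ∀ x y → Algebra._≈_ A x y → D x → D y) where
  open Algebra A

  private
    D-resp : ∀ {x y} → x ≈ y → D x → D y
    D-resp = resp _ _

  -- Terms with one distinguished variable and finitely many parameters are the unary polynomials,
  -- and these suffice to define a congruence.
  Transfers : Rel Carrier u
  Transfers p q = ∀ {n} (t : Term S (Fin 1 ⊎ Fin n)) (c : Fin n → Carrier) →
    D (⟦ t ⟧ [ (λ _ → p) , c ]′) → D (⟦ t ⟧ [ (λ _ → q) , c ]′)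

  preserving⇒Transfers : (γ : Con A) → (∀ {x y} → rel γ x y → D x → D y) →
    ∀ {p q} → rel γ p q → Transfers p q
  preserving⇒Transfers γ preserves p∼q t c =
    preserves (⟦⟧-compatible γ t
      λ { (inj₁ _) → p∼q ; (inj₂ _) → Eq.refl γ })

  private
    sub⁺ : (σ : X → Term S Y) (t : Term S X) {η : X → Carrier} {η′ : Y → Carrier} →
      (∀ x → ⟦ σ x ⟧ η′ ≈ η x) → D (⟦ t ⟧ η) → D (⟦ substitute σ t ⟧ η′)
    sub⁺ σ t r = D-resp (Eq.sym {A = A} Δ (⟦⟧-substitute {A = A} σ t r))

    sub⁻ : (σ : X → Term S Y) (t : Term S X) {η : X → Carrier} {η′ : Y → Carrier} →
      (∀ x → ⟦ σ x ⟧ η′ ≈ η x) → D (⟦ substitute σ t ⟧ η′) → D (⟦ t ⟧ η)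
    sub⁻ σ t r = D-resp (⟦⟧-substitute {A = A} σ t r)

    ≈-refl : ∀ {x} → x ≈ x
    ≈-refl = Eq.refl {A = A} Δ

    -- The first variable is the one to be changed, all others are parameters.
    focus : ∀ k {n} → Fin (ℕ.suc k) ⊎ Fin n → Term S (Fin 1 ⊎ Fin (k + n))
    focus k {n} (inj₁ Fin.zero)    = var (inj₁ Fin.zero)
    focus k {n} (inj₁ (Fin.suc i)) = var (inj₂ (i ↑ˡ n))
    focus k {n} (inj₂ j)           = var (inj₂ (k ↑ʳ j))

    park : ∀ k {n} → Fin (ℕ.suc k) ⊎ Fin n → Term S (Fin k ⊎ Fin (ℕ.suc n))
    park k (inj₁ Fin.zero)    = var (inj₂ Fin.zero)
    park k (inj₁ (Fin.suc i)) = var (inj₁ i)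
    park k (inj₂ j)           = var (inj₂ (Fin.suc j))

    cons : ∀ {n} → Carrier → (Fin n → Carrier) → Fin (ℕ.suc n) → Carrier
    cons x c Fin.zero    = x
    cons x c (Fin.suc j) = c j

  -- Coordinates are changed one at a time. A changed head is moved to the parameters by `park`, so
  -- the induction on `k` has to range over all `t` and `c`.
  Transfers-all : ∀ k {n} (t : Term S (Fin k ⊎ Fin n)) {ps qs : Fin k → Carrier}
    (c : Fin n → Carrier) → (∀ i → Transfers (ps i) (qs i)) →
    D (⟦ t ⟧ [ ps , c ]′) → D (⟦ t ⟧ [ qs , c ]′)
  Transfers-all ℕ.zero t c tr =
    D-resp (⟦⟧-compatible {A = A} Δ t λ { (inj₁ ()) ; (inj₂ j) → ≈-refl })
  Transfers-all (ℕ.suc k) {n} t {ps} {qs} c tr d =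
    sub⁻ (park k) t after
      (Transfers-all k (substitute (park k) t) (cons (qs Fin.zero) c)
        (tr ∘ Fin.suc)
        (sub⁺ (park k) t before
          (sub⁻ (focus k) t (at (qs Fin.zero))
            (tr Fin.zero (substitute (focus k) t) rest
              (sub⁺ (focus k) t (at (ps Fin.zero)) d′)))))
    where
    rest : Fin (k + n) → Carrier
    rest = [ ps ∘ Fin.suc , c ]′ ∘ splitAt k

    with-head : Carrier → Fin (ℕ.suc k) ⊎ Fin n → Carrier
    with-head x = [ cons x (ps ∘ Fin.suc) , c ]′

    -- `ps` and its reassembly from head and tail agree only pointwise.
    d′ : D (⟦ t ⟧ (with-head (ps Fin.zero)))
    d′ = D-resp (⟦⟧-compatible {A = A} Δ t λ
      { (inj₁ Fin.zero) → ≈-refl ; (inj₁ (Fin.suc i)) → ≈-refl ; (inj₂ j) → ≈-refl }) d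

    at : ∀ x v → ⟦ focus k v ⟧ [ (λ _ → x) , rest ]′ ≈ with-head x v
    at x (inj₁ Fin.zero)    = ≈-refl
    at x (inj₁ (Fin.suc i)) =
      Eq.reflexive {A = A} Δ (cong [ ps ∘ Fin.suc , c ]′ (splitAt-↑ˡ k i n))
    at x (inj₂ j)           =
      Eq.reflexive {A = A} Δ (cong [ ps ∘ Fin.suc , c ]′ (splitAt-↑ʳ k n j))

    before : ∀ v → ⟦ park k v ⟧ [ ps ∘ Fin.suc , cons (qs Fin.zero) c ]′
                 ≈ with-head (qs Fin.zero) v
    before (inj₁ Fin.zero)    = ≈-refl
    before (inj₁ (Fin.suc i)) = ≈-refl
    before (inj₂ j)           = ≈-refl

    after : ∀ v → ⟦ park k v ⟧ [ qs ∘ Fin.suc , cons (qs Fin.zero) c ]′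
                ≈ [ qs , c ]′ v
    after (inj₁ Fin.zero)    = ≈-refl
    after (inj₁ (Fin.suc i)) = ≈-refl
    after (inj₂ j)           = ≈-refl

  -- Plugging f(x₁,...,xₖ) into the distinguished variable turns one change into k simultaneous
  -- ones.
  Transfers-op : ∀ f {ps qs} → (∀ i → Transfers (ps i) (qs i)) →
    Transfers (op f ps) (op f qs)
  Transfers-op f {ps} {qs} tr {n} t c d =
    sub⁻ plug t plugged (Transfers-all (arity S f) (substitute plug t) c tr
      (sub⁺ plug t plugged d))
    where
    plug : Fin 1 ⊎ Fin n → Term S (Fin (arity S f) ⊎ Fin n)
    plug (inj₁ _) = app f (var ∘ inj₁)
    plug (inj₂ j) = var (inj₂ j)

    plugged : ∀ {rs} v → ⟦ plug v ⟧ [ rs , c ]′ ≈ [ (λ _ → op f rs) , c ]′ v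
    plugged (inj₁ _) = ≈-refl
    plugged (inj₂ j) = ≈-refl

  syntactic : Con A
  syntactic = record
    { rel           = λ p q → Transfers p q × Transfers q p
    ; isEquivalence = record
      { refl  = (λ t c d → d) , (λ t c d → d)
      ; sym   = λ (pq , qp) → qp , pq
      ; trans = λ (pq , qp) (qr , rq) →
          (λ t c d → qr t c (pq t c d)) , (λ t c d → qp t c (rq t c d))
      }
    ; reflexive     = λ p≈q → preserving⇒Transfers Δ D-resp p≈q
                            , preserving⇒Transfers Δ D-resp (Eq.sym {A = A} Δ p≈q)
    ; compatible    = λ f r → Transfers-op f (proj₁ ∘ r) , Transfers-op f (proj₂ ∘ r)
    }

  syntactic-preserves : ∀ {p q} → rel syntactic p q → D p → D q
  syntactic-preserves (pq , _) = pq {0} (var (inj₁ Fin.zero)) (λ ())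

  syntactic-greatest : (γ : Con A) → (∀ {x y} → rel γ x y → D x → D y) → γ ⊆ syntactic
  syntactic-greatest γ preserves p∼q =
    preserving⇒Transfers γ preserves p∼q , preserving⇒Transfers γ preserves (Eq.sym γ p∼q)

-- A congruence as a subalgebra of the square

module Pairs {S : Signature} {u : Level} {A : Algebra S u} (β : Con A) where
  private module A = Algebra A

  -- The ends are implicit, so an element is given by a proof that they are related; the equality of
  -- `pairs` forgets this proof.
  record Pair : Set u where
    constructor pair
    field
      {fst snd} : A.Carrier
      related   : rel β fst snd

  open Pair public

  pairs : Algebra S u
  pairs = record
    { Carrier       = Pair
    ; _≈_           = λ p q → (fst p A.≈ fst q) × (snd p A.≈ snd q)
    ; isEquivalence = record
      { refl  = E.refl , E.refl
      ; sym   = λ (p , q) → E.sym p , E.sym q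
      ; trans = λ (p , q) (p′ , q′) → E.trans p p′ , E.trans q q′
      }
    ; op            = λ f ps → pair (Con.compatible β f (related ∘ ps))
    ; op-cong       = λ f r → A.op-cong f (proj₁ ∘ r) , A.op-cong f (proj₂ ∘ r)
    } where module E = Eq {A = A} Δ

  private module P = Algebra pairs

  fst-⟦⟧ : (t : Term S X) (η : X → Pair) → fst (P.⟦ t ⟧ η) A.≈ A.⟦ t ⟧ (fst ∘ η)
  fst-⟦⟧ = ⟦⟧-homomorphic {A = pairs} {B = A} fst (λ f xs → Eq.refl {A = A} Δ)

  snd-⟦⟧ : (t : Term S X) (η : X → Pair) → snd (P.⟦ t ⟧ η) A.≈ A.⟦ t ⟧ (snd ∘ η)
  snd-⟦⟧ = ⟦⟧-homomorphic {A = pairs} {B = A} snd (λ f xs → Eq.refl {A = A} Δ)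

  diagonal : A.Carrier → Pair
  diagonal x = pair {x} {x} (Eq.refl β)

  on-fst on-snd : Con A → Con pairs
  on-fst γ = record
    { rel           = λ p q → rel γ (fst p) (fst q)
    ; isEquivalence = record
      { refl = Eq.refl γ ; sym = Eq.sym γ ; trans = Eq.trans γ }
    ; reflexive     = λ p → Con.reflexive γ (proj₁ p)
    ; compatible    = λ f r → Con.compatible γ f r
    }
  on-snd γ = record
    { rel           = λ p q → rel γ (snd p) (snd q)
    ; isEquivalence = record
      { refl = Eq.refl γ ; sym = Eq.sym γ ; trans = Eq.trans γ }
    ; reflexive     = λ p → Con.reflexive γ (proj₂ p)
    ; compatible    = λ f r → Con.compatible γ f r
    }

pairs∈ : (V : Variety u) {A : Alg V} → V ∋ A → (β : Con A) → V ∋ Pairs.pairs β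
pairs∈ V {A} A∈V β s t s≈t η =
    E.trans (fst-⟦⟧ s η) (E.trans (A∈V s t s≈t (fst ∘ η)) (E.sym (fst-⟦⟧ t η)))
  , E.trans (snd-⟦⟧ s η) (E.trans (A∈V s t s≈t (snd ∘ η)) (E.sym (snd-⟦⟧ t η)))
  where
  open Pairs β
  module E = Eq {A = A} Δ

-- The term condition

module _ {S : Signature} {u : Level} {A : Algebra S u} where
  open Algebra A

  centralizes-⊆ˡ : (α β δ : Con A) → α ⊆ δ → Centralizes α β δ
  centralizes-⊆ˡ α β δ α⊆δ t {a} {b} {c} {d} a∼b c∼d eq =
    Eq.trans δ (Eq.sym δ (a→b c)) (Eq.trans δ eq (a→b d))
    where
    a→b : ∀ e → rel δ (⟦ t ⟧ [ a , e ]′) (⟦ t ⟧ [ b , e ]′)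
    a→b e = ⟦⟧-compatible δ t
      λ { (inj₁ i) → α⊆δ (a∼b i) ; (inj₂ j) → Eq.refl δ }

  centralizes-⊆ʳ : (α β δ : Con A) → β ⊆ δ → Centralizes α β δ
  centralizes-⊆ʳ α β δ β⊆δ t a∼b c∼d eq = ⟦⟧-compatible δ t
    λ { (inj₁ i) → Eq.refl δ ; (inj₂ j) → β⊆δ (c∼d j) }

  centralizes-mono : (α α′ β β′ δ : Con A) → α ⊆ α′ → β ⊆ β′ →
    Centralizes α′ β′ δ → Centralizes α β δ
  centralizes-mono α α′ β β′ δ α⊆ β⊆ cen t a∼b c∼d =
    cen t (λ i → α⊆ (a∼b i)) (λ j → β⊆ (c∼d j))

  centralizes-∩ : (α β δ ε : Con A) →
    Centralizes α β δ → Centralizes α β ε → Centralizes α β (δ ∩ ε)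
  centralizes-∩ α β δ ε cδ cε t a∼b c∼d (p , q) =
    cδ t a∼b c∼d p , cε t a∼b c∼d q

module Residual {S : Signature} {u : Level} {A : Algebra S u} (β δ : Con A) where
  open Algebra A
  open Pairs β

  Collapsed : Pred Pair u
  Collapsed p = rel δ (fst p) (snd p)

  Collapsed-resp : ∀ {p q} → rel δ (fst p) (fst q) → rel δ (snd p) (snd q) →
    Collapsed p → Collapsed q
  Collapsed-resp r s d = Eq.trans δ (Eq.sym δ r) (Eq.trans δ d s)

  Collapsed-≈ : ∀ p q → Algebra._≈_ pairs p q → Collapsed p → Collapsed q
  Collapsed-≈ p q (r , s) =
    Collapsed-resp {p} {q} (Con.reflexive δ r) (Con.reflexive δ s)

  module Syn = Syntactic {A = pairs} Collapsed Collapsed-≈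

  Γ : Con pairs
  Γ = Syn.syntactic

  Γ-collapsed : ∀ {p q} → rel Γ p q → Collapsed p → Collapsed q
  Γ-collapsed {p} {q} = Syn.syntactic-preserves {p} {q}

  δ×δ⊆Γ : on-fst δ ∩ on-snd δ ⊆ Γ
  δ×δ⊆Γ {p} {q} = Syn.syntactic-greatest (on-fst δ ∩ on-snd δ)
    (λ {x} {y} (r , s) → Collapsed-resp {x} {y} r s) {p} {q}

  Γ-irrelevant : ∀ {x y} (p q : rel β x y) → rel Γ (pair p) (pair q)
  Γ-irrelevant p q =
    Con.reflexive Γ {pair p} {pair q} (Eq.refl {A = A} Δ , Eq.refl {A = A} Δ)

  -- Stated for term values computed in `A` and for arbitrary proofs of relatedness, so that it
  -- applies directly to both sides of a term condition.
  Γ-⟦⟧ : (t : Term S X) {ηx ηy ηz ηw : X → Carrier}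
    (xy : ∀ v → rel β (ηx v) (ηy v)) (zw : ∀ v → rel β (ηz v) (ηw v)) →
    (∀ v → rel Γ (pair (xy v)) (pair (zw v))) →
    (p : rel β (⟦ t ⟧ ηx) (⟦ t ⟧ ηy)) (q : rel β (⟦ t ⟧ ηz) (⟦ t ⟧ ηw)) →
    rel Γ (pair p) (pair q)
  Γ-⟦⟧ (var v)    xy zw r p q =
    Eq.trans Γ {pair p} {pair (xy v)} {pair q} (Γ-irrelevant p (xy v))
      (Eq.trans Γ {pair (xy v)} {pair (zw v)} {pair q} (r v) (Γ-irrelevant (zw v) q))
  Γ-⟦⟧ (app f ts) xy zw r p q =
    Eq.trans Γ {pair p} {pair p′} {pair q} (Γ-irrelevant p p′)
      (Eq.trans Γ {pair p′} {pair q′} {pair q}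
        (Con.compatible Γ f {λ i → pair (ps i)} {λ i → pair (qs i)}
          (λ i → Γ-⟦⟧ (ts i) xy zw r (ps i) (qs i)))
        (Γ-irrelevant q′ q))
    where
    ps = λ i → ⟦⟧-compatible β (ts i) xy
    qs = λ i → ⟦⟧-compatible β (ts i) zw
    p′ = Con.compatible β f ps
    q′ = Con.compatible β f qs

  -- The largest congruence α with C(α,β;δ).
  residual : Con A
  residual = record
    { rel           = λ x y → rel Γ (diagonal x) (diagonal y)
    ; isEquivalence = record
      { refl  = λ {x} → Eq.refl Γ {diagonal x}
      ; sym   = λ {x} {y} → Eq.sym Γ {diagonal x} {diagonal y}
      ; trans = λ {x} {y} {z} → Eq.trans Γ {diagonal x} {diagonal y} {diagonal z}
      }
    ; reflexive     = λ {x} {y} p → Con.reflexive Γ {diagonal x} {diagonal y} (p , p)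
    -- The operation is read as a term, because the diagonal of `op f xs` and the operation applied
    -- to diagonals carry different proofs of relatedness.
    ; compatible    = λ f {xs} {ys} r →
        Γ-⟦⟧ (app f var) (λ i → Eq.refl β) (λ i → Eq.refl β) r (Eq.refl β) (Eq.refl β)
    }

  -- A unary polynomial of `pairs` acts on the two ends by one term with β-related parameters, so
  -- the term condition with a single changed variable applies.
  centralizes⇒⊆residual : (α : Con A) → Centralizes α β δ → α ⊆ residual
  centralizes⇒⊆residual α cen x∼y = transfers x∼y , transfers (Eq.sym α x∼y)
    where
    transfers : ∀ {x y} → rel α x y → Syn.Transfers (diagonal x) (diagonal y)
    transfers {x} {y} x∼y {n} t c eq =
      Eq.trans δ (Con.reflexive δ (fst-at y))
        (Eq.trans δ (cen t (λ _ → x∼y) (related ∘ c)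
            (Eq.trans δ (Eq.sym δ (Con.reflexive δ (fst-at x)))
              (Eq.trans δ eq (Con.reflexive δ (snd-at x)))))
          (Eq.sym δ (Con.reflexive δ (snd-at y))))
      where
      η : Carrier → Fin 1 ⊎ Fin n → Pair
      η z = [ (λ _ → diagonal z) , c ]′

      fst-at : ∀ z → fst (Algebra.⟦_⟧ pairs t (η z)) ≈ ⟦ t ⟧ [ (λ _ → z) , fst ∘ c ]′
      fst-at z = Eq.trans {A = A} Δ (fst-⟦⟧ t (η z)) (⟦⟧-compatible {A = A} Δ t
        λ { (inj₁ _) → Eq.refl {A = A} Δ ; (inj₂ _) → Eq.refl {A = A} Δ })

      snd-at : ∀ z → snd (Algebra.⟦_⟧ pairs t (η z)) ≈ ⟦ t ⟧ [ (λ _ → z) , snd ∘ c ]′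
      snd-at z = Eq.trans {A = A} Δ (snd-⟦⟧ t (η z)) (⟦⟧-compatible {A = A} Δ t
        λ { (inj₁ _) → Eq.refl {A = A} Δ ; (inj₂ _) → Eq.refl {A = A} Δ })

  -- The rows (t(a,c), t(a,d)) and (t(b,c), t(b,d)) are values of t at Γ-related arguments: diagonal
  -- pairs first, then the pairs (c,d) on both sides.
  ⊆residual⇒centralizes : (α : Con A) → α ⊆ residual → Centralizes α β δ
  ⊆residual⇒centralizes α α⊆ t {a} {b} {c} {d} a∼b c∼d =
    Γ-collapsed {pair (row a)} {pair (row b)}
      (Γ-⟦⟧ t (rows a) (rows b)
        (λ { (inj₁ i) → α⊆ (a∼b i) ; (inj₂ j) → Γ-irrelevant (c∼d j) (c∼d j) })
        (row a) (row b))
    where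
    rows : ∀ e v → rel β ([ e , c ]′ v) ([ e , d ]′ v)
    rows e (inj₁ i) = Eq.refl β
    rows e (inj₂ j) = c∼d j

    row : ∀ e → rel β (⟦ t ⟧ [ e , c ]′) (⟦ t ⟧ [ e , d ]′)
    row e = ⟦⟧-compatible β t (rows e)

module _ {S : Signature} {u : Level} {A : Algebra S u} where

  centralizes-∨ : (φ ψ β δ : Con A) →
    Centralizes φ β δ → Centralizes ψ β δ → Centralizes (φ ∨ ψ) β δ
  centralizes-∨ φ ψ β δ cφ cψ = ⊆residual⇒centralizes (φ ∨ ψ)
    (Cg-least residual
      λ { (inj₁ p) → centralizes⇒⊆residual φ cφ p
        ; (inj₂ p) → centralizes⇒⊆residual ψ cψ p })
    where open Residual β δ

-- Consequences of congruence modularity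

module Modular {u : Level} (V : Variety u) (modular : CongruenceModular V) where

  -- Gumm's shifting lemma.
  shift : ∀ {B : Alg V} → V ∋ B → (α β γ : Con B) → α ∩ β ⊆ γ →
    ∀ x y z w → rel α x y → rel γ x y → rel β z x → rel β y w → rel α z w →
    rel γ z w
  shift B∈V α β γ α∩β⊆γ x y z w αxy γxy βzx βyw αzw =
    -- The path z, x, y, w puts (z,w) into ((α ∩ γ) ∨ β) ∩ α. By modularity this is (α ∩ γ) ∨ (β ∩
    -- α), and both parts lie below γ.
    Cg-least γ (λ { (inj₁ (_ , p)) → p ; (inj₂ (p , q)) → α∩β⊆γ (q , p) })
      (proj₂ (modular _ B∈V (α ∩ γ) β α proj₁)
        ( trans (base (inj₂ βzx)) (trans (base (inj₁ (αxy , γxy))) (base (inj₂ βyw)))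
        , αzw))

  module _ {A : Alg V} (A∈V : V ∋ A) where
    open Algebra A

    module _ (β δ : Con A) where
      open Pairs β
      open Residual β δ

      private
        pairs∈V : V ∋ pairs
        pairs∈V = pairs∈ V A∈V β

      -- Write p = (p₁,p₂) and q = (q₁,q₂) with p₁ ≈ q₁. Shifting moves the Γ-edge from p to q onto
      -- the edge from (p₂,p₂) to (p₂,q₂); the former pair is collapsed, hence so is the latter.
      Γ∩fst⊆snd : on-fst Δ ∩ Γ ⊆ on-snd δ
      Γ∩fst⊆snd {p} {q} (p₁≈q₁ , pΓq) = Γ-collapsed {z} {w}
        (shift pairs∈V (on-fst Δ) (on-snd Δ) Γ
          (λ {x} {y} → Con.reflexive Γ {x} {y}) p q z w
          p₁≈q₁ pΓq (Eq.refl {A = A} Δ) (Eq.refl {A = A} Δ) (Eq.refl {A = A} Δ))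
        (Eq.refl δ)
        where
        z w : Pair
        z = diagonal (snd p)
        w = pair {snd p} {snd q} (Eq.trans β (Eq.sym β (related p))
              (Eq.trans β (Con.reflexive β p₁≈q₁) (related q)))

      -- Modularity reduces this to `Γ∩fst⊆snd`: p and q are joined through the diagonal pairs of
      -- their first ends, by a step of δ × δ ⊆ Γ between steps that fix the first end.
      Γ∩on-fst⊆on-snd : on-fst δ ∩ Γ ⊆ on-snd δ
      Γ∩on-fst⊆on-snd {p} {q} (p₁∼q₁ , pΓq) = Cg-least (on-snd δ)
        (λ { (inj₁ (_ , r)) → r ; {a} {b} (inj₂ r) → Γ∩fst⊆snd {a} {b} r })
        (proj₂ (modular pairs pairs∈V (on-fst δ ∩ on-snd δ) (on-fst Δ) Γ
            (λ {a} {b} → δ×δ⊆Γ {a} {b}))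
          ( trans {b = diagonal (fst p)} (base (inj₂ (Eq.refl {A = A} Δ)))
              (trans {b = diagonal (fst q)} (base (inj₁ (p₁∼q₁ , p₁∼q₁)))
                (base (inj₂ (Eq.refl {A = A} Δ))))
          , pΓq))

    -- The columns (t(a,c), t(b,c)) and (t(a,d), t(b,d)) are Γ-related since c and d are α-related;
    -- the δ-relation then passes from first ends to second ends.
    centralizes-sym : (α β δ : Con A) → Centralizes α β δ → Centralizes β α δ
    centralizes-sym α β δ cen t {a} {b} {c} {d} a∼b c∼d eq =
      Γ∩on-fst⊆on-snd β δ {pair (column c)} {pair (column d)}
        (eq , Γ-⟦⟧ t (columns c) (columns d)
          (λ { (inj₁ i) → Γ-irrelevant (a∼b i) (a∼b i)
             ; (inj₂ j) → centralizes⇒⊆residual α cen (c∼d j) })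
          (column c) (column d))
      where
      open Pairs β
      open Residual β δ

      columns : ∀ e v → rel β ([ a , e ]′ v) ([ b , e ]′ v)
      columns e (inj₁ i) = a∼b i
      columns e (inj₂ j) = Eq.refl β

      column : ∀ e → rel β (⟦ t ⟧ [ a , e ]′) (⟦ t ⟧ [ b , e ]′)
      column e = ⟦⟧-compatible β t (columns e)

    -- A shift of `on-snd ε` along Γ, with Γ formed for the smaller δ: it moves the edge from
    -- (t(a,c), t(a,c)) to (t(a,c), t(a,d)) onto the same edge with b for a.
    centralizes-up : (α β δ ε : Con A) → δ ⊆ ε → Centralizes α β δ → Centralizes α β ε
    centralizes-up α β δ ε δ⊆ε cen t {a} {b} {c} {d} a∼b c∼d eq =
      shift (pairs∈ V A∈V β) (on-fst Δ) Γ (on-snd ε)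
        (λ {p} {q} r → δ⊆ε (Γ∩fst⊆snd β δ {p} {q} r))
        (diagonal (⟦ t ⟧ [ a , c ]′)) (pair (row a))
        (diagonal (⟦ t ⟧ [ b , c ]′)) (pair (row b))
        (Eq.refl {A = A} Δ) eq
        (centralizes⇒⊆residual α cen (⟦⟧-compatible α t
          λ { (inj₁ i) → Eq.sym α (a∼b i) ; (inj₂ j) → Eq.refl α }))
        (Γ-⟦⟧ t (rows a) (rows b)
          (λ { (inj₁ i) → centralizes⇒⊆residual α cen (a∼b i)
             ; (inj₂ j) → Γ-irrelevant (c∼d j) (c∼d j) })
          (row a) (row b))
        (Eq.refl {A = A} Δ)
      where
      open Pairs β
      open Residual β δ

      rows : ∀ e v → rel β ([ e , c ]′ v) ([ e , d ]′ v)
      rows e (inj₁ i) = Eq.refl β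
      rows e (inj₂ j) = c∼d j

      row : ∀ e → rel β (⟦ t ⟧ [ e , c ]′) (⟦ t ⟧ [ e , d ]′)
      row e = ⟦⟧-compatible β t (rows e)

-- Compactness

module _ {S : Signature} {u : Level} {A : Algebra S u} where

  ∨-least : (α β γ : Con A) → α ⊆ γ → β ⊆ γ → α ∨ β ⊆ γ
  ∨-least α β γ α⊆γ β⊆γ = Cg-least γ λ { (inj₁ p) → α⊆γ p ; (inj₂ p) → β⊆γ p }

  ∨-mono : (α α′ β β′ : Con A) → α ⊆ α′ → β ⊆ β′ → α ∨ β ⊆ α′ ∨ β′
  ∨-mono α α′ β β′ α⊆ β⊆ = ∨-least α β (α′ ∨ β′)
    (λ p → base (inj₁ (α⊆ p))) (λ p → base (inj₂ (β⊆ p)))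

  complement-sym : (α β : Con A) → IsComplement α β → IsComplement β α
  complement-sym α β ((_ , ∇⊆) , (∩⊆ , _)) =
      ( (λ _ → tt)
      , λ p → ∨-least α β (β ∨ α) (λ q → base (inj₂ q)) (λ q → base (inj₁ q)) (∇⊆ p))
    , ((λ (p , q) → ∩⊆ (q , p)) , Con.reflexive (β ∩ α))

  join : List (Con A) → Con A
  join = foldr _∨_ Δ

  join-++ˡ : ∀ αs βs → join αs ⊆ join (αs ++ βs)
  join-++ˡ []       βs = Con.reflexive (join βs)
  join-++ˡ (α ∷ αs) βs =
    ∨-mono α α (join αs) (join (αs ++ βs)) (λ p → p) (join-++ˡ αs βs)

  join-++ʳ : ∀ αs βs → join βs ⊆ join (αs ++ βs)
  join-++ʳ []       βs p = p
  join-++ʳ (α ∷ αs) βs p = base (inj₂ (join-++ʳ αs βs p))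

  FinitelyRelated : ∀ {ℓ} → Pred (Con A) ℓ → Rel (Algebra.Carrier A) _
  FinitelyRelated P x y = ∃ λ αs → All P αs × rel (join αs) x y

  finitelyRelated-all : ∀ {ℓ} (P : Pred (Con A) ℓ) k {xs ys : Fin k → Algebra.Carrier A} →
    (∀ i → FinitelyRelated P (xs i) (ys i)) →
    ∃ λ αs → All P αs × (∀ i → rel (join αs) (xs i) (ys i))
  finitelyRelated-all P ℕ.zero    r = [] , [] , λ ()
  finitelyRelated-all P (ℕ.suc k) r =
    let αs , Pαs , p  = r Fin.zero
        βs , Pβs , ps = finitelyRelated-all P k (r ∘ Fin.suc)
    in αs ++ βs , ++⁺ Pαs Pβs ,
       λ { Fin.zero → join-++ˡ αs βs p ; (Fin.suc i) → join-++ʳ αs βs (ps i) }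

module Compactness {u : Level} (em : ExcludedMiddle (suc u))
  {S : Signature} {A : Algebra S u} where
  open Classical em
  open Algebra A

  ⋁-upper : (P : Pred (Con A) u) (α : Con A) → P α → α ⊆ ⋁ P
  ⋁-upper P α Pα p = base (⌊⌋-intro (α , Pα , p))

  ⋁-least : (P : Pred (Con A) u) (γ : Con A) → (∀ α → P α → α ⊆ γ) → ⋁ P ⊆ γ
  ⋁-least P γ below = Cg-least γ λ {a} {b} p →
    let α , Pα , q = ⌊⌋-elim {∃ λ α → P α × rel α a b} p in below α Pα q

  -- A derivation uses finitely many members of P because operations have finite arity.
  ⋁⇒finitelyRelated : (P : Pred (Con A) u) → ∀ {x y} →
    rel (⋁ P) x y → FinitelyRelated P x y
  ⋁⇒finitelyRelated P (base {a} {b} p) =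
    let α , Pα , q = ⌊⌋-elim {∃ λ α → P α × rel α a b} p in α ∷ [] , Pα ∷ [] , base (inj₁ q)
  ⋁⇒finitelyRelated P (equal p) = [] , [] , p
  ⋁⇒finitelyRelated P (sym p) =
    let αs , Pαs , q = ⋁⇒finitelyRelated P p in αs , Pαs , Eq.sym (join αs) q
  ⋁⇒finitelyRelated P (trans p q) =
    let αs , Pαs , p′ = ⋁⇒finitelyRelated P p
        βs , Pβs , q′ = ⋁⇒finitelyRelated P q
    in αs ++ βs , ++⁺ Pαs Pβs ,
       Eq.trans (join (αs ++ βs)) (join-++ˡ αs βs p′) (join-++ʳ αs βs q′)
  ⋁⇒finitelyRelated P (comp f ps) =
    let αs , Pαs , qs = finitelyRelated-all P (arity S f) (λ i → ⋁⇒finitelyRelated P (ps i))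
    in αs , Pαs , Con.compatible (join αs) f qs

  principal : Carrier → Carrier → Con A
  principal x y = Cg (λ a b → (a ≡ x) × (b ≡ y))

  principal-least : ∀ {x y} (γ : Con A) → rel γ x y → principal x y ⊆ γ
  principal-least γ p = Cg-least γ λ { (refl , refl) → p }

  principal-compact : ∀ x y → Compact (principal x y)
  principal-compact x y P ⊆⋁P =
    let αs , Pαs , p = ⋁⇒finitelyRelated P (⊆⋁P (base (refl , refl)))
    in αs , Pαs , principal-least (join αs) p

  Δ-compact : Compact {A = A} Δ
  Δ-compact P _ = [] , [] , λ p → p

  -- Downward closure is left out, so that complemented congruences qualify.
  record Ideal : Set (suc (suc u)) where
    field
      Member   : Pred (Con A) (suc u)
      Δ-member : Member Δ
      ∨-member : ∀ α β → Member α → Member β → Member (α ∨ β)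

  open Ideal

  below : Con A → Ideal
  below γ = record
    { Member   = λ α → Lift (suc u) (α ⊆ γ)
    ; Δ-member = lift (Con.reflexive γ)
    ; ∨-member = λ α β p q → lift (∨-least α β γ (lower p) (lower q))
    }

  compactBelow : Con A → Ideal
  compactBelow γ = record
    { Member   = λ α → Compact α × (α ⊆ γ)
    ; Δ-member = Δ-compact , Con.reflexive γ
    ; ∨-member = λ α β (cα , p) (cβ , q) → ∨-compact α β cα cβ , ∨-least α β γ p q
    }

  module _ (I J : Ideal) where

    Either : Pred (Con A) u
    Either α = ⌊ Member I α ⊎ Member J α ⌋

    ⊆⋁-Eitherˡ : (α : Con A) → Member I α → α ⊆ ⋁ Either
    ⊆⋁-Eitherˡ α i = ⋁-upper Either α (⌊⌋-intro {Member I α ⊎ Member J α} (inj₁ i))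

    ⊆⋁-Eitherʳ : (α : Con A) → Member J α → α ⊆ ⋁ Either
    ⊆⋁-Eitherʳ α j = ⋁-upper Either α (⌊⌋-intro {Member I α ⊎ Member J α} (inj₂ j))

    Covered : Con A → Set (suc u)
    Covered κ = ∃ λ β → ∃ λ γ → Member I β × Member J γ × (κ ⊆ β ∨ γ)

    -- Sorts the finite join: members of I are collected into β, the others into γ.
    join-covered : ∀ {αs} → All Either αs → Covered (join αs)
    join-covered [] = Δ , Δ , Δ-member I , Δ-member J , equal
    join-covered {α ∷ αs} (e ∷ es) with ⌊⌋-elim {Member I α ⊎ Member J α} e | join-covered es
    ... | inj₁ i | β , γ , β∈I , γ∈J , αs⊆ =
      α ∨ β , γ , ∨-member I α β i β∈I , γ∈J ,
      ∨-least α (join αs) ((α ∨ β) ∨ γ) (λ p → base (inj₁ (base (inj₁ p))))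
        (λ p → ∨-mono β (α ∨ β) γ γ (λ q → base (inj₂ q)) (λ q → q) (αs⊆ p))
    ... | inj₂ j | β , γ , β∈I , γ∈J , αs⊆ =
      β , α ∨ γ , β∈I , ∨-member J α γ j γ∈J ,
      ∨-least α (join αs) (β ∨ (α ∨ γ)) (λ p → base (inj₂ (base (inj₁ p))))
        (λ p → ∨-mono β β γ (α ∨ γ) (λ q → q) (λ q → base (inj₂ q)) (αs⊆ p))

    compact-covered : (κ : Con A) → Compact κ → κ ⊆ ⋁ Either → Covered κ
    compact-covered κ cκ κ⊆ =
      let αs , es , κ⊆αs = cκ Either κ⊆
          β , γ , β∈I , γ∈J , αs⊆ = join-covered es
      in β , γ , β∈I , γ∈J , λ p → αs⊆ (κ⊆αs p)

-- Semidegenerate congruence modular varieties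

module SemidegenerateModular {u : Level} (em : ExcludedMiddle (suc u)) (V : Variety u)
  (modular : CongruenceModular V) (semidegenerate : Semidegenerate V) where
  open Classical em
  open Compactness em
  open Modular V modular

  decide : (P : Set u) → Dec P
  decide P = map′ lower lift (em {P = Lift (suc u) P})

  oneElement⇒trivial : (B : Alg V) → V ∋ B → HasOneElementSubalgebra B → Trivial B
  oneElement⇒trivial B B∈V one = decidable-stable (decide (Trivial B))
    (λ nontrivial → semidegenerate B B∈V nontrivial one)

  module _ {A : Alg V} (A∈V : V ∋ A) where
    open Algebra A

    -- C(∇,α;δ) makes the diagonal a one-element subalgebra of the quotient by Γ.
    ∇-centralizes⇒⊆ : (α δ : Con A) → Centralizes ∇ α δ → α ⊆ δ
    ∇-centralizes⇒⊆ α δ cen {x} {y} x∼y =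
      Γ-collapsed {diagonal x} {pair x∼y}
        (oneElement⇒trivial (pairs / Γ) (quotient∈ V (pairs∈ V A∈V α) Γ)
          (diagonal x , λ f {ps} → closed f {ps}) (diagonal x) (pair x∼y))
        (Eq.refl δ)
      where
      open Pairs α
      open Residual α δ

      closed : ∀ f {ps} → (∀ i → rel Γ (ps i) (diagonal x)) →
        rel Γ (Algebra.op pairs f ps) (diagonal x)
      closed f {ps} r =
        Eq.trans Γ {Algebra.op pairs f ps} {pair fx} {diagonal x}
          (Con.compatible Γ f {ps} {λ _ → diagonal x} r)
          (Eq.trans Γ {pair fx} {diagonal _} {diagonal x}
            (Γ-irrelevant fx (Eq.refl α)) (centralizes⇒⊆residual ∇ cen tt))
        where fx = Con.compatible α f {λ _ → x} {λ _ → x} (λ _ → Eq.refl α)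

    -- With a fixed, the finitely many pairs (f(a,…,a), a) generate ∇: modulo them
    -- {a} is a subalgebra.
    ∇-compact : Compact {A = A} ∇
    ∇-compact P ∇⊆⋁P with decide Carrier
    -- On an empty carrier the empty join is already `∇`.
    ... | no empty = [] , [] , λ {a} _ → contradiction a empty
    ... | yes a =
      let αs , Pαs , r = finitelyRelated-all P (#ops (signature V))
            {xs = λ f → op f (λ _ → a)} {ys = λ _ → a}
            (λ f → ⋁⇒finitelyRelated P (∇⊆⋁P tt))
      in αs , Pαs , λ {x} {y} _ →
           oneElement⇒trivial (A / join αs) (quotient∈ V A∈V (join αs))
             (a , λ f s → Eq.trans (join αs) (Con.compatible (join αs) f s) (r f)) x y

    -- The term condition holds trivially at α and at β, hence at α ∩ β, and it is upward closed.
    ∩⊆⇒centralizes : (α β δ : Con A) → α ∩ β ⊆ δ → Centralizes α β δ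
    ∩⊆⇒centralizes α β δ α∩β⊆δ = centralizes-up A∈V α β (α ∩ β) δ α∩β⊆δ
      (centralizes-∩ α β α β (centralizes-⊆ˡ α β α (λ p → p))
        (centralizes-⊆ʳ α β β (λ p → p)))

    -- Takes the place of distributivity: an inclusion may be checked against φ and ψ separately.
    cover : (φ ψ σ δ : Con A) → ∇ ⊆ φ ∨ ψ →
      Centralizes φ σ δ → Centralizes ψ σ δ → σ ⊆ δ
    cover φ ψ σ δ ∇⊆ cφ cψ = ∇-centralizes⇒⊆ σ δ
      (centralizes-mono ∇ (φ ∨ ψ) σ σ δ ∇⊆ (λ p → p) (centralizes-∨ φ ψ σ δ cφ cψ))

    -- For comaximal φ, ψ the commutator is the intersection: φ centralizes φ ∩ ψ as a part of ψ,
    -- and by symmetry ψ centralizes it as a part of φ.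
    cover-∩ : (φ ψ δ : Con A) → ∇ ⊆ φ ∨ ψ → Centralizes φ ψ δ → φ ∩ ψ ⊆ δ
    cover-∩ φ ψ δ ∇⊆ cen = cover φ ψ (φ ∩ ψ) δ ∇⊆
      (centralizes-mono φ φ (φ ∩ ψ) ψ δ (λ p → p) proj₂ cen)
      (centralizes-mono ψ ψ (φ ∩ ψ) φ δ (λ p → p) proj₁ (centralizes-sym A∈V φ ψ δ cen))

    centralizes-∨∨ : (φ ψ θ : Con A) → Centralizes φ ψ θ →
      Centralizes (θ ∨ φ) (θ ∨ ψ) θ
    centralizes-∨∨ φ ψ θ cen = centralizes-sym A∈V (θ ∨ ψ) (θ ∨ φ) θ
      (centralizes-∨ θ ψ (θ ∨ φ) θ (centralizes-⊆ˡ θ (θ ∨ φ) θ (λ p → p))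
        (centralizes-sym A∈V (θ ∨ φ) ψ θ
          (centralizes-∨ θ φ ψ θ (centralizes-⊆ˡ θ ψ θ (λ p → p)) cen)))

    -- The term condition survives arbitrary meets, so it holds at the commutator itself, and from
    -- there upwards.
    commutator⊆⇒centralizes : (α β δ : Con A) → [ α , β ] ⊆ δ → Centralizes α β δ
    commutator⊆⇒centralizes α β δ ⊆δ = centralizes-up A∈V α β [ α , β ] δ ⊆δ
      λ t a∼b c∼d p → ⌊⌋-intro (λ ε cen → cen t a∼b c∼d (⌊⌋-elim {∀ ε → Centralizes α β ε → rel ε _ _} p ε cen))

    centralizes⇒commutator⊆ : (α β δ : Con A) → Centralizes α β δ → [ α , β ] ⊆ δ
    centralizes⇒commutator⊆ α β δ cen p =
      ⌊⌋-elim {∀ ε → Centralizes α β ε → rel ε _ _} p δ cen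

    complement-centralizes : (α β : Con A) → IsComplement α β → ∀ δ → Centralizes α β δ
    complement-centralizes α β (_ , ∩⊆Δ , _) δ =
      ∩⊆⇒centralizes α β δ (λ p → Con.reflexive δ (∩⊆Δ p))

    ⊆∨∩complement : (α β σ : Con A) → IsComplement α β → σ ⊆ α ∨ (σ ∩ β)
    ⊆∨∩complement α β σ ((_ , ∇⊆) , _) = cover α β σ (α ∨ (σ ∩ β)) ∇⊆
      (centralizes-⊆ˡ α σ (α ∨ (σ ∩ β)) (λ p → base (inj₁ p)))
      (∩⊆⇒centralizes β σ (α ∨ (σ ∩ β)) (λ (p , q) → base (inj₂ (q , p))))

    -- For the join, α′ ⊆ β ∨ (α′ ∩ β′). For the meet, α and β both centralize α′ ∩ β′ at `Δ`, hence
    -- so does α ∨ β.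
    complement-∨ : (α α′ β β′ : Con A) → IsComplement α α′ → IsComplement β β′ →
      IsComplement (α ∨ β) (α′ ∩ β′)
    complement-∨ α α′ β β′ cα@((_ , ∇⊆α) , _) cβ =
      ((λ _ → tt) , λ p → ∇⊆ p) ,
      (cover-∩ (α ∨ β) (α′ ∩ β′) Δ ∇⊆
        (centralizes-∨ α β (α′ ∩ β′) Δ
          (centralizes-mono α α (α′ ∩ β′) α′ Δ (λ p → p) proj₁ (complement-centralizes α α′ cα Δ))
          (centralizes-mono β β (α′ ∩ β′) β′ Δ (λ p → p) proj₂ (complement-centralizes β β′ cβ Δ)))
      , Con.reflexive ((α ∨ β) ∩ (α′ ∩ β′)))
      where
      ∇⊆ : ∇ ⊆ (α ∨ β) ∨ (α′ ∩ β′)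
      ∇⊆ p = ∨-least α α′ ((α ∨ β) ∨ (α′ ∩ β′)) (λ q → base (inj₁ (base (inj₁ q))))
        (λ q → ∨-mono β (α ∨ β) (α′ ∩ β′) (α′ ∩ β′) (λ r → base (inj₂ r)) (λ r → r)
          (⊆∨∩complement β β′ α′ cβ q))
        (∇⊆α p)

    complementedBelow : Con A → Ideal {A = A}
    complementedBelow γ = record
      { Member   = λ α → Complemented α × (α ⊆ γ)
      ; Δ-member = (∇ , ((λ _ → tt) , λ p → base (inj₂ p)) , (proj₁ , λ p → p , tt))
                 , Con.reflexive γ
      ; ∨-member = λ α β ((α′ , cα) , p) ((β′ , cβ) , q) →
          ((α′ ∩ β′) , complement-∨ α α′ β β′ cα cβ) , ∨-least α β γ p q
      }

    -- If α is not below μ then μ ∨ α = ∇, and both μ and α centralize β modulo μ.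
    maximal-dichotomy : (μ α β : Con A) → Maximal μ → IsComplement α β → α ⊆ μ ⊎ β ⊆ μ
    maximal-dichotomy μ α β (_ , max) c with decide (α ⊆ μ)
    ... | yes α⊆μ = inj₁ α⊆μ
    ... | no  α⊈μ = inj₂ (cover μ α β μ (λ p → proj₂ μ∨α≐∇ p)
      (centralizes-⊆ˡ μ β μ (λ p → p)) (complement-centralizes α β c μ))
      where
      μ∨α≐∇ : μ ∨ α ≐ ∇
      μ∨α≐∇ = decidable-stable (decide (μ ∨ α ≐ ∇)) λ proper →
        α⊈μ (λ p → proj₁ (max (μ ∨ α) (λ q → base (inj₁ q)) proper) (base (inj₂ p)))

    module _ (zorn : ZornsLemma (suc u) u u u) (σ : Con A) (σ-proper : ¬ (σ ≐ ∇)) where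
      private
        ProperAbove : Set (suc u)
        ProperAbove = ∃ λ φ → (σ ⊆ φ) × ¬ (φ ≐ ∇)

        poset : Poset (suc u) u u
        poset = record
          { Carrier        = ProperAbove
          ; _≈_            = λ x y → proj₁ x ≐ proj₁ y
          ; _≤_            = λ x y → proj₁ x ⊆ proj₁ y
          ; isPartialOrder = record
            { isPreorder = record
              { isEquivalence = record
                { refl  = (λ p → p) , (λ p → p)
                ; sym   = λ (p , q) → q , p
                ; trans = λ (p , p′) (q , q′) → (λ r → q (p r)) , (λ r → p′ (q′ r))
                }
              ; reflexive     = λ (p , _) → p
              ; trans         = λ p q r → q (p r)
              }
            ; antisym    = λ p q → p , q
            }
          }

        module _ (C : Pred ProperAbove u)
          (chain : ∀ x y → C x → C y → (proj₁ x ⊆ proj₁ y) ⊎ (proj₁ y ⊆ proj₁ x)) where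

          -- Adjoining σ makes the chain inhabited, which the empty join in `join-dominated` relies
          -- on.
          C′ : Pred ProperAbove u
          C′ x = C x ⊎ (proj₁ x ⊆ σ)

          chain′ : ∀ x y → C′ x → C′ y → (proj₁ x ⊆ proj₁ y) ⊎ (proj₁ y ⊆ proj₁ x)
          chain′ x y (inj₁ Cx) (inj₁ Cy) = chain x y Cx Cy
          chain′ x y (inj₂ x⊆) _         = inj₁ (λ p → proj₁ (proj₂ y) (x⊆ p))
          chain′ x y _         (inj₂ y⊆) = inj₂ (λ p → proj₁ (proj₂ x) (y⊆ p))

          Dominated : Con A → Set (suc u)
          Dominated φ = ∃ λ x → C′ x × (φ ⊆ proj₁ x)

          join-dominated : ∀ {αs} → All (λ φ → ⌊ Dominated φ ⌋) αs → Dominated (join αs)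
          join-dominated [] = (σ , (λ p → p) , σ-proper) , inj₂ (λ p → p) , Con.reflexive σ
          join-dominated {α ∷ αs} (d ∷ ds)
            with ⌊⌋-elim {Dominated α} d | join-dominated ds
          ... | x , Cx , α⊆x | y , Cy , αs⊆y with chain′ x y Cx Cy
          ... | inj₁ x⊆y = y , Cy , ∨-least α (join αs) (proj₁ y) (λ p → x⊆y (α⊆x p)) αs⊆y
          ... | inj₂ y⊆x = x , Cx , ∨-least α (join αs) (proj₁ x) α⊆x (λ p → y⊆x (αs⊆y p))

          bound : Con A
          bound = ⋁ (λ φ → ⌊ Dominated φ ⌋)

          upper : ∀ x → C′ x → proj₁ x ⊆ bound
          upper x Cx = ⋁-upper _ (proj₁ x) (⌊⌋-intro {Dominated (proj₁ x)} (x , Cx , λ p → p))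

          -- By compactness of `∇` a single member of the chain would already be `∇`.
          bound-proper : ¬ (bound ≐ ∇)
          bound-proper (_ , ∇⊆) =
            let αs , ds , ∇⊆αs = ∇-compact (λ φ → ⌊ Dominated φ ⌋) (λ p → ∇⊆ p)
                x , _ , αs⊆x   = join-dominated ds
            in proj₂ (proj₂ x) ((λ _ → tt) , λ p → αs⊆x (∇⊆αs p))

          chain-bound : ∃ λ (b : ProperAbove) → ∀ x → C x → proj₁ x ⊆ proj₁ b
          chain-bound =
            (bound , upper (σ , (λ p → p) , σ-proper) (inj₂ (λ p → p)) , bound-proper) ,
            λ x Cx → upper x (inj₁ Cx)

      maximal-above : ∃ λ μ → Maximal μ × (σ ⊆ μ)
      maximal-above =
        let (μ , σ⊆μ , μ-proper) , max = zorn poset chain-bound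
        in μ , (μ-proper , λ ψ μ⊆ψ ψ-proper →
             max (ψ , (λ p → μ⊆ψ (σ⊆μ p)) , ψ-proper) μ⊆ψ) , σ⊆μ

  -- Congruences of quotients

  module _ {A : Alg V} (χ : Con A) where

    unquotient : Con (A / χ) → Con A
    unquotient β = record
      { rel           = rel β
      ; isEquivalence = Con.isEquivalence β
      ; reflexive     = λ p → Con.reflexive β (Con.reflexive χ p)
      ; compatible    = Con.compatible β
      }

    unquotient-cover : (b : BCon (A / χ)) → ∇ ⊆ unquotient (con b) ∨ unquotient (neg b)
    unquotient-cover b p =
      -- The join formed in `A / χ` also contains χ-steps; these are absorbed because `con b`
      -- contains χ.
      Cg-least (quotient {θ = χ} (unquotient (con b) ∨ unquotient (neg b))
          (λ q → base (inj₁ (Con.reflexive (con b) q))))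
        base (proj₂ (proj₁ (BCon.isComplement b)) p)

    unquotient-∩ : (b : BCon (A / χ)) → unquotient (con b) ∩ unquotient (neg b) ⊆ χ
    unquotient-∩ b = proj₁ (proj₂ (BCon.isComplement b))

    quotientBCon : (β γ : Con A) → χ ⊆ β → χ ⊆ γ → ∇ ⊆ β ∨ γ → β ∩ γ ⊆ χ → BCon (A / χ)
    quotientBCon β γ χ⊆β χ⊆γ ∇⊆ ∩⊆ = record
      { con          = quotient {θ = χ} β χ⊆β
      ; neg          = quotient {θ = χ} γ χ⊆γ
      ; isComplement =
          ( (λ _ → tt)
          , λ p → Cg-least (unquotient (quotient {θ = χ} β χ⊆β ∨ quotient {θ = χ} γ χ⊆γ)) base (∇⊆ p))
        , (∩⊆ , λ p → χ⊆β p , χ⊆γ p)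
      }

  module _ (B : Alg V) where

    twoValued⇒atMost2 : ((b : BCon B) → con b ⊆ Δ ⊎ ∇ ⊆ con b) → AtMost 2 (BConSetoid B)
    twoValued⇒atMost2 two = record
      { to        = λ b → code (decide (con b ⊆ Δ))
      ; cong      = λ {b} {c} b≐c → code-cong {con b} {con c} (decide (con b ⊆ Δ)) (decide (con c ⊆ Δ)) b≐c
      ; injective = λ {b} {c} → code-injective b c (decide (con b ⊆ Δ)) (decide (con c ⊆ Δ))
      }
      where
      code : ∀ {P : Set u} → Dec P → Fin 2
      code (yes _) = Fin.zero
      code (no _)  = Fin.suc Fin.zero

      code-cong : ∀ {β γ : Con B} (p : Dec (β ⊆ Δ)) (q : Dec (γ ⊆ Δ)) → β ≐ γ → code p ≡ code q
      code-cong (yes _) (yes _) _         = refl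
      code-cong (no _)  (no _)  _         = refl
      code-cong (yes p) (no ¬q) (_ , γ⊆β) = ⊥-elim (¬q (λ r → p (γ⊆β r)))
      code-cong (no ¬p) (yes q) (β⊆γ , _) = ⊥-elim (¬p (λ r → q (β⊆γ r)))

      code-injective : (b c : BCon B) (p : Dec (con b ⊆ Δ)) (q : Dec (con c ⊆ Δ)) →
        code p ≡ code q → con b ≐ con c
      code-injective b c (yes p) (yes q) _ =
        (λ r → Con.reflexive (con c) (p r)) , (λ r → Con.reflexive (con b) (q r))
      code-injective b c (no ¬p) (no ¬q) _ with two b | two c
      ... | inj₁ p  | _       = ⊥-elim (¬p (λ r → p r))
      ... | inj₂ _  | inj₁ q  = ⊥-elim (¬q (λ r → q r))
      ... | inj₂ ∇⊆ | inj₂ ∇⊆′ = (λ _ → ∇⊆′ tt) , (λ _ → ∇⊆ tt)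

    atMost2⇒twoValued : AtMost 2 (BConSetoid B) → (b : BCon B) → con b ⊆ Δ ⊎ ∇ ⊆ con b
    atMost2⇒twoValued inj b = conclude (pigeonhole (to ⊥B) (to ⊤B) (to b))
      where
      open Injection inj

      ⊥B ⊤B : BCon B
      ⊥B = record { con = Δ ; neg = ∇
                  ; isComplement = ((λ _ → tt) , λ p → base (inj₂ p)) , (proj₁ , λ p → p , tt) }
      ⊤B = record { con = ∇ ; neg = Δ
                  ; isComplement = ((λ _ → tt) , λ p → base (inj₁ p)) , (proj₂ , λ p → tt , p) }

      pigeonhole : (i j k : Fin 2) → k ≡ i ⊎ k ≡ j ⊎ i ≡ j
      pigeonhole Fin.zero           Fin.zero           k                  = inj₂ (inj₂ refl)
      pigeonhole (Fin.suc Fin.zero) (Fin.suc Fin.zero) k                  = inj₂ (inj₂ refl)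
      pigeonhole Fin.zero           (Fin.suc Fin.zero) Fin.zero           = inj₁ refl
      pigeonhole Fin.zero           (Fin.suc Fin.zero) (Fin.suc Fin.zero) = inj₂ (inj₁ refl)
      pigeonhole (Fin.suc Fin.zero) Fin.zero           Fin.zero           = inj₂ (inj₁ refl)
      pigeonhole (Fin.suc Fin.zero) Fin.zero           (Fin.suc Fin.zero) = inj₁ refl

      conclude : to b ≡ to ⊥B ⊎ to b ≡ to ⊤B ⊎ to ⊥B ≡ to ⊤B → con b ⊆ Δ ⊎ ∇ ⊆ con b
      conclude (inj₁ b=⊥)        = inj₁ (λ p → proj₁ (injective {b} {⊥B} b=⊥) p)
      conclude (inj₂ (inj₁ b=⊤)) = inj₂ (λ p → proj₂ (injective {b} {⊤B} b=⊤) p)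
      -- Here `Δ` and `∇` coincide, so every congruence is `∇`.
      conclude (inj₂ (inj₂ ⊥=⊤)) =
        inj₂ (λ p → Con.reflexive (con b) (proj₂ (injective {⊥B} {⊤B} ⊥=⊤) p))

  -- The four conditions

  module _ {A : Alg V} (A∈V : V ∋ A) (θ : Con A) where

    Separated : Con A → Con A → Set (suc u)
    Separated φ ψ = ∃ λ (α : BCon A) → (con α ⊆ θ ∨ φ) × (neg α ⊆ θ ∨ ψ)

    -- θ ∨ φ and θ ∨ ψ are complementary modulo θ; α lifts the first. Then ¬α ⊆ θ ∨ ψ, since modulo
    -- θ ∨ ψ it is centralized by φ ⊆ α ∨ θ and by ψ.
    CBLP⇒separated : CBLP θ →
      ∀ φ ψ → φ ∨ ψ ≐ ∇ → [ φ , ψ ] ⊆ θ → Separated φ ψ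
    CBLP⇒separated cblp φ ψ (_ , ∇⊆) comm⊆ =
      α , (λ p → ⊆b (base (inj₁ p))) ,
      cover A∈V φ ψ (neg α) (θ ∨ ψ) (λ p → ∇⊆ p)
        (centralizes-mono φ (con α ∨ θ) (neg α) (neg α) (θ ∨ ψ)
          (λ p → b⊆ (base (inj₂ p))) (λ p → p)
          (centralizes-∨ (con α) θ (neg α) (θ ∨ ψ)
            (complement-centralizes A∈V (con α) (neg α) (BCon.isComplement α) (θ ∨ ψ))
            (centralizes-⊆ˡ θ (neg α) (θ ∨ ψ) (λ p → base (inj₁ p)))))
        (centralizes-⊆ˡ ψ (neg α) (θ ∨ ψ) (λ p → base (inj₂ p)))
      where
      ∇⊆′ : ∇ ⊆ (θ ∨ φ) ∨ (θ ∨ ψ)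
      ∇⊆′ p = ∨-mono φ (θ ∨ φ) ψ (θ ∨ ψ) (λ q → base (inj₂ q)) (λ q → base (inj₂ q)) (∇⊆ p)

      lifted = cblp (quotientBCon θ (θ ∨ φ) (θ ∨ ψ) (λ p → base (inj₁ p)) (λ p → base (inj₁ p)) ∇⊆′
        (cover-∩ A∈V (θ ∨ φ) (θ ∨ ψ) θ ∇⊆′
          (centralizes-∨∨ A∈V φ ψ θ (commutator⊆⇒centralizes A∈V φ ψ θ comm⊆))))
      α  = proj₁ lifted
      ⊆b : con α ∨ θ ⊆ θ ∨ φ
      ⊆b = proj₁ (proj₂ lifted)
      b⊆ : θ ∨ φ ⊆ con α ∨ θ
      b⊆ = proj₂ (proj₂ lifted)

    -- The preimages φ, ψ of a complementary pair satisfy [φ,ψ] = φ ∩ ψ = θ exactly. For φ ⊆ α ∨ θ,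
    -- cover by α and ¬α, using ¬α ⊆ ψ.
    separated⇒CBLP :
      (∀ φ ψ → φ ∨ ψ ≐ ∇ → [ φ , ψ ] ≐ θ → Separated φ ψ) → CBLP θ
    separated⇒CBLP sep b = α ,
      ∨-least (con α) θ φ (λ p → ∨-least θ φ φ θ⊆φ (λ q → q) (α⊆ p)) θ⊆φ ,
      cover A∈V (con α) (neg α) φ (con α ∨ θ) (λ p → proj₂ (proj₁ (BCon.isComplement α)) p)
        (centralizes-⊆ˡ (con α) φ (con α ∨ θ) (λ p → base (inj₁ p)))
        (centralizes-mono (neg α) ψ φ φ (con α ∨ θ)
          (λ p → ∨-least θ ψ ψ θ⊆ψ (λ q → q) (¬α⊆ p)) (λ p → p)
          (∩⊆⇒centralizes A∈V ψ φ (con α ∨ θ) (λ (p , q) → base (inj₂ (unquotient-∩ θ b (q , p))))))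
      where
      φ ψ : Con A
      φ = unquotient θ (con b)
      ψ = unquotient θ (neg b)

      θ⊆φ : θ ⊆ φ
      θ⊆φ = Con.reflexive (con b)

      θ⊆ψ : θ ⊆ ψ
      θ⊆ψ = Con.reflexive (neg b)

      ∇⊆ : ∇ ⊆ φ ∨ ψ
      ∇⊆ = unquotient-cover θ b

      separated = sep φ ψ ((λ _ → tt) , λ p → ∇⊆ p)
        ( centralizes⇒commutator⊆ A∈V φ ψ θ (∩⊆⇒centralizes A∈V φ ψ θ (unquotient-∩ θ b))
        , λ p → cover-∩ A∈V φ ψ [ φ , ψ ] ∇⊆
            (commutator⊆⇒centralizes A∈V φ ψ [ φ , ψ ] (λ q → q)) (θ⊆φ p , θ⊆ψ p))
      α   = proj₁ separated
      α⊆  = proj₁ (proj₂ separated)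
      ¬α⊆ = proj₂ (proj₂ separated)

    -- Complemented congruences below μ are closed under finite joins, so a compact κ meets only one
    -- of them.
    ◇-covered : (φ μ κ : Con A) → Compact κ → κ ⊆ φ ∨ μ ◇ →
      ∃ λ (α : BCon A) → (con α ⊆ μ) × (κ ⊆ φ ∨ con α)
    ◇-covered φ μ κ cκ κ⊆ =
      let β , γ , β⊆φ , ((γ′ , c) , γ⊆μ) , κ⊆′ = compact-covered I J κ cκ λ p → ⊆⋁ (κ⊆ p)
      in record { con = γ ; neg = γ′ ; isComplement = c } , γ⊆μ ,
         λ p → ∨-mono β φ γ γ (lower β⊆φ) (λ q → q) (κ⊆′ p)
      where
      I J : Ideal {A = A}
      I = below φ
      J = complementedBelow A∈V μ

      ⊆⋁ : φ ∨ μ ◇ ⊆ ⋁ Either I J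
      ⊆⋁ = ∨-least φ (μ ◇) (⋁ Either I J)
        (⊆⋁-Eitherˡ I J φ (lift λ p → p))
        (⋁-least (λ β → ⌊ Complemented β ⌋ × (β ⊆ μ)) (⋁ Either I J) λ α (c , α⊆μ) →
          ⊆⋁-Eitherʳ I J α (⌊⌋-elim {Complemented α} c , α⊆μ))

    ⊆◇ : (μ : Con A) (α : BCon A) → con α ⊆ μ → con α ⊆ μ ◇
    ⊆◇ μ α α⊆μ = ⋁-upper (λ β → ⌊ Complemented β ⌋ × (β ⊆ μ)) (con α)
      (⌊⌋-intro {Complemented (con α)} (neg α , BCon.isComplement α) , α⊆μ)

    -- Every congruence is a join of principal ones, which are compact.
    compact-cover : (β γ : Con A) → ∇ ⊆ β ∨ γ → Covered (compactBelow β) (compactBelow γ) ∇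
    compact-cover β γ ∇⊆ = compact-covered I J ∇ (∇-compact A∈V) λ p →
      ∨-least β γ (⋁ Either I J)
        (λ {x} {y} q → ⊆⋁-Eitherˡ I J (principal x y)
          (principal-compact x y , principal-least β q) (base (refl , refl)))
        (λ {x} {y} q → ⊆⋁-Eitherʳ I J (principal x y)
          (principal-compact x y , principal-least γ q) (base (refl , refl)))
        (∇⊆ p)
      where
      I J : Ideal {A = A}
      I = compactBelow β
      J = compactBelow γ

    -- The hypothesis is applied to φ ∨ α and ψ ∩ ¬α, whose commutator lies in
    -- (θ ∨ α) ∩ ¬α ⊆ θ.
    separated-∨ : (∀ φ ψ → φ ∨ ψ ≐ ∇ → [ φ , ψ ] ⊆ θ → Separated φ ψ) →
      (α : BCon A) (φ ψ : Con A) → ∇ ⊆ φ ∨ ψ → [ φ , ψ ] ⊆ θ ∨ con α →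
      Separated (φ ∨ con α) ψ
    separated-∨ sep α φ ψ ∇⊆ comm⊆ =
      let ε , ε⊆ , ¬ε⊆ = sep φ′ ψ′ ((λ _ → tt) , λ p → ∇⊆′ p)
            (centralizes⇒commutator⊆ A∈V φ′ ψ′ θ φ′-ψ′)
      in ε , ε⊆ , λ p → ∨-mono θ θ ψ′ ψ (λ q → q) proj₁ (¬ε⊆ p)
      where
      a a′ φ′ ψ′ : Con A
      a  = con α
      a′ = neg α
      φ′ = φ ∨ a
      ψ′ = ψ ∩ a′

      α-complement : IsComplement a a′
      α-complement = BCon.isComplement α

      a-a′ : Centralizes a a′ θ
      a-a′ = complement-centralizes A∈V a a′ α-complement θ

      [θ∨a]∩a′⊆θ : (θ ∨ a) ∩ a′ ⊆ θ
      [θ∨a]∩a′⊆θ = cover A∈V a a′ ((θ ∨ a) ∩ a′) θ (λ p → proj₂ (proj₁ α-complement) p)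
        (centralizes-mono a a ((θ ∨ a) ∩ a′) a′ θ (λ p → p) proj₂ a-a′)
        (centralizes-mono a′ a′ ((θ ∨ a) ∩ a′) (θ ∨ a) θ (λ p → p) proj₁
          (centralizes-sym A∈V (θ ∨ a) a′ θ
            (centralizes-∨ θ a a′ θ (centralizes-⊆ˡ θ a′ θ (λ p → p)) a-a′)))

      φ′-ψ′ : Centralizes φ′ ψ′ θ
      φ′-ψ′ = centralizes-∨ φ a ψ′ θ
        (centralizes-up A∈V φ ψ′ ((θ ∨ a) ∩ a′) θ [θ∨a]∩a′⊆θ
          (centralizes-∩ φ ψ′ (θ ∨ a) a′
            (centralizes-mono φ φ ψ′ ψ (θ ∨ a) (λ p → p) proj₁
              (commutator⊆⇒centralizes A∈V φ ψ (θ ∨ a) comm⊆))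
            (centralizes-⊆ʳ φ ψ′ a′ proj₂)))
        (centralizes-mono a a ψ′ a′ θ (λ p → p) proj₂ a-a′)

      ∇⊆′ : ∇ ⊆ φ′ ∨ ψ′
      ∇⊆′ p = ∨-least φ ψ (φ′ ∨ ψ′) (λ q → base (inj₁ (base (inj₁ q))))
        (λ q → ∨-mono a φ′ ψ′ ψ′ (λ r → base (inj₂ r)) (λ r → r)
          (⊆∨∩complement A∈V a a′ ψ α-complement q))
        (∇⊆ p)

    separated-∨◇ : CompactClosed A →
      (∀ φ ψ → φ ∨ ψ ≐ ∇ → [ φ , ψ ] ⊆ θ → Separated φ ψ) →
      (μ β γ : Con A) → θ ∨ μ ◇ ⊆ β → θ ∨ μ ◇ ⊆ γ → ∇ ⊆ β ∨ γ → β ∩ γ ⊆ θ ∨ μ ◇ →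
      ∃ λ (ε : BCon A) → (con ε ⊆ β) × (neg ε ⊆ γ)
    separated-∨◇ closed sep μ β γ χ⊆β χ⊆γ ∇⊆ ∩⊆χ =
      let β′ , γ′ , (cβ′ , β′⊆β) , (cγ′ , γ′⊆γ) , ∇⊆′ = compact-cover β γ ∇⊆
          -- β′ and γ′ were chosen compact so that their commutator is compact too, and one α
          -- replaces all of μ◇.
          α , α⊆μ , comm⊆ = ◇-covered θ μ [ β′ , γ′ ] (closed β′ γ′ cβ′ cγ′)
            (centralizes⇒commutator⊆ A∈V β′ γ′ (θ ∨ μ ◇)
              (∩⊆⇒centralizes A∈V β′ γ′ (θ ∨ μ ◇) (λ (p , q) → ∩⊆χ (β′⊆β p , γ′⊆γ q))))
          ε , ε⊆ , ¬ε⊆ = separated-∨ sep α β′ γ′ ∇⊆′ comm⊆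
      in ε ,
         (λ p → ∨-least θ (β′ ∨ con α) β (λ q → χ⊆β (base (inj₁ q)))
           (∨-least β′ (con α) β β′⊆β (λ q → χ⊆β (base (inj₂ (⊆◇ μ α α⊆μ q))))) (ε⊆ p)) ,
         (λ p → ∨-least θ γ′ γ (λ q → χ⊆γ (base (inj₁ q))) γ′⊆γ (¬ε⊆ p))

    separated⇒twoValued : CompactClosed A →
      (∀ φ ψ → φ ∨ ψ ≐ ∇ → [ φ , ψ ] ⊆ θ → Separated φ ψ) →
      ∀ μ → Maximal μ → (b : BCon (A / (θ ∨ μ ◇))) → con b ⊆ Δ ⊎ ∇ ⊆ con b
    separated⇒twoValued closed sep μ max b =
      conclude (separated-∨◇ closed sep μ β γ χ⊆β χ⊆γ (unquotient-cover χ b) (unquotient-∩ χ b))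
      where
      χ β γ : Con A
      χ = θ ∨ μ ◇
      β = unquotient χ (con b)
      γ = unquotient χ (neg b)

      χ⊆β : χ ⊆ β
      χ⊆β = Con.reflexive (con b)

      χ⊆γ : χ ⊆ γ
      χ⊆γ = Con.reflexive (neg b)

      conclude : (∃ λ (ε : BCon A) → (con ε ⊆ β) × (neg ε ⊆ γ)) → con b ⊆ Δ ⊎ ∇ ⊆ con b
      conclude (ε , ε⊆β , ¬ε⊆γ) = by-cases (maximal-dichotomy A∈V μ (con ε) (neg ε) max c)
        where
        c : IsComplement (con ε) (neg ε)
        c = BCon.isComplement ε

        ¬ε : BCon A
        ¬ε = record { con = neg ε ; neg = con ε ; isComplement = complement-sym (con ε) (neg ε) c }

        by-cases : con ε ⊆ μ ⊎ neg ε ⊆ μ → con b ⊆ Δ ⊎ ∇ ⊆ con b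
        -- ε ⊆ μ◇ ⊆ γ together with ¬ε ⊆ γ makes γ equal to `∇`, so β = β ∩ γ ⊆ χ.
        by-cases (inj₁ ε⊆μ) = inj₁ λ p → unquotient-∩ χ b
          (p , ∨-least (con ε) (neg ε) γ (λ q → χ⊆γ (base (inj₂ (⊆◇ μ ε ε⊆μ q)))) ¬ε⊆γ
                 (proj₂ (proj₁ c) tt))
        by-cases (inj₂ ¬ε⊆μ) = inj₂ λ p → ∨-least (con ε) (neg ε) β ε⊆β
          (λ q → χ⊆β (base (inj₂ (⊆◇ μ ¬ε ¬ε⊆μ q)))) (proj₂ (proj₁ c) p)

    twoValued⇒separated : ZornsLemma (suc u) u u u →
      (∀ μ → Maximal μ → (b : BCon (A / (θ ∨ μ ◇))) → con b ⊆ Δ ⊎ ∇ ⊆ con b) →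
      ∀ φ ψ → φ ∨ ψ ≐ ∇ → [ φ , ψ ] ≐ θ → Separated φ ψ
    twoValued⇒separated zorn two φ ψ (_ , ∇⊆) (comm⊆θ , θ⊆comm) =
      let β , γ , ((β′ , c) , β⊆φ) , (_ , γ⊆ψ) , ∇⊆βγ =
            compact-covered I J ∇ (∇-compact A∈V) ∇⊆⋁
      in record { con = β ; neg = β′ ; isComplement = c } ,
         (λ p → base (inj₂ (β⊆φ p))) ,
         -- β′ ⊆ γ: both β and γ centralize β′ modulo γ, and together they cover `∇`.
         (λ p → base (inj₂ (γ⊆ψ (cover A∈V β γ β′ γ ∇⊆βγ
           (complement-centralizes A∈V β β′ c γ) (centralizes-⊆ˡ γ β′ γ (λ q → q)) p))))
      where
      I J : Ideal {A = A}
      I = complementedBelow A∈V φ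
      J = complementedBelow A∈V ψ

      σ : Con A
      σ = ⋁ Either I J

      φ-ψ : Centralizes φ ψ θ
      φ-ψ = commutator⊆⇒centralizes A∈V φ ψ θ comm⊆θ

      -- Here the equality [φ,ψ] = θ enters through θ ⊆ [φ,ψ]; `escape` requires θ below both φ and
      -- ψ.
      θ⊆φ∩ψ : θ ⊆ φ ∩ ψ
      θ⊆φ∩ψ p = centralizes⇒commutator⊆ A∈V φ ψ (φ ∩ ψ)
        (∩⊆⇒centralizes A∈V φ ψ (φ ∩ ψ) (λ q → q)) (θ⊆comm p)

      -- By compactness ψ ∨ ε = ∇ for some ε ∈ B(Con(A)) below μ, whence ¬ε ⊆ ψ.
      escape : (φ ψ μ : Con A) → θ ⊆ ψ → ∇ ⊆ φ ∨ ψ → φ ⊆ θ ∨ μ ◇ →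
        (∀ α → Complemented α → α ⊆ ψ → α ⊆ μ) → μ ≐ ∇
      escape φ ψ μ θ⊆ψ ∇⊆ φ⊆ below-μ =
        let ε , ε⊆μ , ∇⊆ψε = ◇-covered ψ μ ∇ (∇-compact A∈V) (λ p →
              ∨-least φ ψ (ψ ∨ μ ◇) (λ q → ∨-mono θ ψ (μ ◇) (μ ◇) θ⊆ψ (λ r → r) (φ⊆ q))
                (λ q → base (inj₁ q)) (∇⊆ p))
            (_ , ∇⊆ε) , _ = BCon.isComplement ε
            ¬ε⊆ψ : neg ε ⊆ ψ
            ¬ε⊆ψ = cover A∈V ψ (con ε) (neg ε) ψ ∇⊆ψε
              (centralizes-⊆ˡ ψ (neg ε) ψ (λ q → q))
              (complement-centralizes A∈V (con ε) (neg ε) (BCon.isComplement ε) ψ)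
            complemented : Complemented (neg ε)
            complemented = con ε , complement-sym (con ε) (neg ε) (BCon.isComplement ε)
        in (λ _ → tt) , λ p → ∨-least (con ε) (neg ε) μ ε⊆μ (below-μ (neg ε) complemented ¬ε⊆ψ) (∇⊆ε p)

      not-below-maximal : (μ : Con A) → Maximal μ → ¬ (σ ⊆ μ)
      not-below-maximal μ max σ⊆μ = conclude (two μ max b)
        where
        χ : Con A
        χ = θ ∨ μ ◇

        ∇⊆χ : ∇ ⊆ (χ ∨ φ) ∨ (χ ∨ ψ)
        ∇⊆χ p = ∨-mono φ (χ ∨ φ) ψ (χ ∨ ψ) (λ q → base (inj₂ q)) (λ q → base (inj₂ q)) (∇⊆ p)

        ∩⊆χ : (χ ∨ φ) ∩ (χ ∨ ψ) ⊆ χ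
        ∩⊆χ = cover-∩ A∈V (χ ∨ φ) (χ ∨ ψ) χ ∇⊆χ (centralizes-∨∨ A∈V φ ψ χ
          (centralizes-up A∈V φ ψ θ χ (λ p → base (inj₁ p)) φ-ψ))

        b : BCon (A / χ)
        b = quotientBCon χ (χ ∨ φ) (χ ∨ ψ) (λ p → base (inj₁ p)) (λ p → base (inj₁ p)) ∇⊆χ ∩⊆χ

        conclude : ¬ (con b ⊆ Δ ⊎ ∇ ⊆ con b)
        conclude (inj₁ φ⊆) = proj₁ max (escape φ ψ μ (λ p → proj₂ (θ⊆φ∩ψ p)) (λ p → ∇⊆ p)
          (λ p → φ⊆ (base (inj₂ p)))
          (λ α c α⊆ψ p → σ⊆μ (⊆⋁-Eitherʳ I J α (c , α⊆ψ) p)))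
        -- Now χ ∨ φ is `∇`, so ψ lies in (χ ∨ φ) ∩ (χ ∨ ψ) ⊆ χ, and φ and ψ exchange roles.
        conclude (inj₂ ∇⊆φ) = proj₁ max (escape ψ φ μ (λ p → proj₁ (θ⊆φ∩ψ p))
          (λ p → ∨-least φ ψ (ψ ∨ φ) (λ q → base (inj₂ q)) (λ q → base (inj₁ q)) (∇⊆ p))
          (λ p → ∩⊆χ (∇⊆φ tt , base (inj₂ p)))
          (λ α c α⊆φ p → σ⊆μ (⊆⋁-Eitherˡ I J α (c , α⊆φ) p)))

      ∇⊆⋁ : ∇ ⊆ σ
      ∇⊆⋁ p = proj₂ (decidable-stable (decide (σ ≐ ∇)) λ proper →
        let μ , max , σ⊆μ = maximal-above A∈V zorn σ proper
        in not-below-maximal μ max σ⊆μ) p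

theorem6p3 : ∀ {u : Level} (em : ExcludedMiddle (suc u)) → ZornsLemma (suc u) u u u →
    let open Classical em in
    (V : Variety u) → CongruenceModular V → Semidegenerate V →
    (closed : ∀ B → V ∋ B → CompactClosed B) →
    (∀ B (B∈V : V ∋ B) → PreservesBooleanCenter B (closed B B∈V)) →
    ∀ (A : Alg V) → V ∋ A → (θ : Con A) →
    let
      cond1 = CBLP θ
      cond2 = ∀ (φ ψ : Con A) → φ ∨ ψ ≐ ∇ → [ φ , ψ ] ⊆ θ →
                ∃ λ (α : BCon A) → (con α ⊆ θ ∨ φ) × (neg α ⊆ θ ∨ ψ)
      cond3 = ∀ (φ ψ : Con A) → φ ∨ ψ ≐ ∇ → [ φ , ψ ] ≐ θ →
                ∃ λ (α : BCon A) → (con α ⊆ θ ∨ φ) × (neg α ⊆ θ ∨ ψ)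
      cond4 = ∀ (φ : Con A) → Maximal φ → AtMost 2 (BConSetoid (A / (θ ∨ φ ◇)))
    in (cond1 ⇔ cond2) × (cond1 ⇔ cond3) × (cond1 ⇔ cond4)
theorem6p3 em zorn V modular semidegenerate closed _ A A∈V θ =
    mk⇔ 1⇒2 (λ c2 → 3⇒1 (2⇒3 c2))
  , mk⇔ (λ c1 → 2⇒3 (1⇒2 c1)) 3⇒1
  , mk⇔ (λ c1 φ max → twoValued⇒atMost2 (A / (θ ∨ φ ◇))
          (separated⇒twoValued A∈V θ (closed A A∈V) (1⇒2 c1) φ max))
        (λ c4 → 3⇒1 (twoValued⇒separated A∈V θ zorn
          (λ φ max → atMost2⇒twoValued (A / (θ ∨ φ ◇)) (c4 φ max))))
  where
  open Classical em
  open SemidegenerateModular em V modular semidegenerate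
  1⇒2 = CBLP⇒separated A∈V θ
  3⇒1 = separated⇒CBLP A∈V θ

  2⇒3 : (∀ φ ψ → φ ∨ ψ ≐ ∇ → [ φ , ψ ] ⊆ θ → Separated A∈V θ φ ψ) →
        (∀ φ ψ → φ ∨ ψ ≐ ∇ → [ φ , ψ ] ≐ θ → Separated A∈V θ φ ψ)
  2⇒3 c2 φ ψ ∨≐∇ ≐θ = c2 φ ψ ∨≐∇ (proj₁ ≐θ)
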